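{- Let $n\ge 1$. The set $A_n=\{G_\alpha : \alpha\in\{0,1\}^n \text{ breaks the ballot condition}\}$ is a $\mathbb{Q}$-linear basis of the ideal $I_n$.
   Context: Let $R_n=\mathbb{Q}[\theta_1,\dots,\theta_n]$ be the polynomial ring in anticommuting variables over $\mathbb{Q}$ (exterior algebra): $\theta_i\theta_j=-\theta_j\theta_i$ for $i\ne j$, $\theta_i^2=0$. For $A=\{a_1<\cdots<a_r\}\subseteq[n]$ put $\theta_A=\theta_{a_1}\cdots\theta_{a_r}$, and $F_{1^r}=\sum_{A\subseteq[n],|A|=r}\theta_A$ (so $F_{1^0}=1$). Let $I_n$ be the ideal of $R_n$ generated by $F_{1^r}$, $1\le r\le n$. A sequence $\alpha=(a_1,\dots,a_n)\in\{0,1\}^n$ is a ballot sequence if $\sum_{i=1}^r a_i\le r/2$ for all $1\le r\le n$; it breaks the ballot condition (at position $r$) if $\sum_{i=1}^r a_i>r/2$ for some $1\le r\le n$. For a $0$-$1$ string $u$ let $m_1(u)$ be its number of $1$s. For $\alpha\in\{0,1\}^n$ (written as a string) the element $G_\alpha\in R_n$ is defined recursively: $G_{1^s0^{n-s}}=F_{1^s}$ for $0\le s\le n$; otherwise $\alpha$ is uniquely of the form $u01^s0^{n-k-s}$ with $s\ge 1$ and $u$ a string of length $k-1$, and $$G_{u01^s0^{n-k-s}}=G_{u1^s0^{n-k-s+1}}-(-1)^{m_1(u)}\theta_k\,G_{u1^{s-1}0^{n-k-s+2}}.$$ -}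

module Defs where

open import Algebra.Bundles using (Ring)
open import Algebra.Module.Bundles using (LeftModule)
import Algebra.Properties.Semiring.Exp as Exp
open import Data.Digit using (Bit)
open import Data.Fin.Base using (Fin; toℕ)
open import Data.Fin.Patterns using (0F; 1F)
open import Data.Fin.Subset using (Subset; inside; outside; ∣_∣)
open import Data.Fin.Subset.Properties using (_∈?_)
open import Data.List.Base using (List; []; _∷_; _++_; allFin; filter; foldr; map; reverse; take)
open import Data.List.Relation.Unary.All using (All)
open import Data.List.Relation.Unary.Unique.Propositional using (Unique)
open import Data.Nat.Base as ℕ using (ℕ; zero; suc; _≤_; _<_)
open import Data.Nat.ListAction using (sum)
open import Data.Nat.Properties using (_≟_)
open import Data.Product.Base using (∃; ∃-syntax; _×_; _,_; proj₂)
open import Data.Rational.Base as ℚ using (ℚ; 0ℚ; 1ℚ)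
open import Data.Rational.Properties as ℚₚ using ()
open import Data.Vec.Base as Vec using (Vec; toList)
open import Level using (Level; 0ℓ; _⊔_)
open import Relation.Binary.PropositionalEquality using (_≡_; _≢_; cong)
open import Relation.Unary using (Pred; _≐_)

private
  variable
    c ℓ m ℓm i p : Level

------------------------------------------------------------------------
-- Ideals and bases

-- The two-sided ideal generated by S.  Closure under negation follows
-- from closure under multiplication by - 1#.
module _ (A : Ring c ℓ) where
  open Ring A

  data Ideal⟨_⟩ (S : Pred Carrier p) : Pred Carrier (c ⊔ ℓ ⊔ p) where
    generator : ∀ {x} → S x → Ideal⟨ S ⟩ x
    0-closed  : Ideal⟨ S ⟩ 0#
    +-closed  : ∀ {x y} → Ideal⟨ S ⟩ x → Ideal⟨ S ⟩ y → Ideal⟨ S ⟩ (x + y)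
    *-closedˡ : ∀ a {x} → Ideal⟨ S ⟩ x → Ideal⟨ S ⟩ (a * x)
    *-closedʳ : ∀ a {x} → Ideal⟨ S ⟩ x → Ideal⟨ S ⟩ (x * a)
    ≈-closed  : ∀ {x y} → x ≈ y → Ideal⟨ S ⟩ x → Ideal⟨ S ⟩ y

-- The families considered are (b j), for j ranging over the indices
-- that satisfy J.  Independence is that of a family: it makes the b j
-- with J j pairwise distinct whenever the scalars are non-trivial.
module _ {K : Ring c ℓ} (M : LeftModule K m ℓm) {I : Set i} where
  open Ring K using (Carrier; _≈_; 0#)
  open LeftModule M

  linearCombination : (I → Carrierᴹ) → (I → Carrier) → List I → Carrierᴹ
  linearCombination b a = foldr (λ j x → a j *ₗ b j +ᴹ x) 0ᴹ

  LinearlyIndependent : Pred I p → (I → Carrierᴹ) → Set _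
  LinearlyIndependent J b =
    ∀ js → Unique js → All J js →
    ∀ a → linearCombination b a js ≈ᴹ 0ᴹ → All (λ j → a j ≈ 0#) js

  Span : Pred I p → (I → Carrierᴹ) → Pred Carrierᴹ _
  Span J b x = ∃[ js ] All J js × ∃[ a ] x ≈ᴹ linearCombination b a js

  IsBasisOf : Pred I p → (I → Carrierᴹ) → Pred Carrierᴹ ℓ → Set _
  IsBasisOf J b V = LinearlyIndependent J b × V ≐ Span J b

------------------------------------------------------------------------
-- The ring ℚ[θ₁,…,θₙ] in anticommuting variables, presented as the
-- associative unital ℚ-algebra with generators θ i and relations
-- θ-anticomm and θ-square.  Elements are expressions; equality is the
-- congruence _≈_.  The variable θₖ is θ i with toℕ i = k - 1.

infix  4 _≈_
infixl 6 _+_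
infixl 7 _*_
infix  8 -_

data Expr (n : ℕ) : Set where
  con : ℚ → Expr n
  θ   : Fin n → Expr n
  _+_ : Expr n → Expr n → Expr n
  _*_ : Expr n → Expr n → Expr n
  -_  : Expr n → Expr n

data _≈_ {n : ℕ} : Expr n → Expr n → Set where
  refl  : ∀ {x} → x ≈ x
  sym   : ∀ {x y} → x ≈ y → y ≈ x
  trans : ∀ {x y z} → x ≈ y → y ≈ z → x ≈ z

  +-cong : ∀ {x y u v} → x ≈ y → u ≈ v → x + u ≈ y + v
  *-cong : ∀ {x y u v} → x ≈ y → u ≈ v → x * u ≈ y * v
  -‿cong : ∀ {x y} → x ≈ y → - x ≈ - y

  +-assoc     : ∀ x y z → (x + y) + z ≈ x + (y + z)
  +-comm      : ∀ x y → x + y ≈ y + x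
  +-identityˡ : ∀ x → con 0ℚ + x ≈ x
  -‿inverseˡ  : ∀ x → - x + x ≈ con 0ℚ
  *-assoc     : ∀ x y z → (x * y) * z ≈ x * (y * z)
  *-identityˡ : ∀ x → con 1ℚ * x ≈ x
  distribˡ    : ∀ x y z → x * (y + z) ≈ x * y + x * z
  distribʳ    : ∀ x y z → (y + z) * x ≈ y * x + z * x

  con-+       : ∀ p q → con (p ℚ.+ q) ≈ con p + con q
  con-*       : ∀ p q → con (p ℚ.* q) ≈ con p * con q
  con-central : ∀ q x → con q * x ≈ x * con q

  θ-anticomm : ∀ {i j} → i ≢ j → θ i * θ j ≈ - (θ j * θ i)
  θ-square   : ∀ i → θ i * θ i ≈ con 0ℚ

R : ℕ → Ring 0ℓ 0ℓ
R n = record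
  { Carrier = Expr n
  ; _≈_     = _≈_
  ; _+_     = _+_
  ; _*_     = _*_
  ; -_      = -_
  ; 0#      = con 0ℚ
  ; 1#      = con 1ℚ
  ; isRing  = record
    { +-isAbelianGroup = record
      { isGroup = record
        { isMonoid = record
          { isSemigroup = record
            { isMagma = record
              { isEquivalence = record { refl = refl ; sym = sym ; trans = trans }
              ; ∙-cong        = +-cong
              }
            ; assoc = +-assoc
            }
          ; identity = +-identityˡ , λ x → trans (+-comm x _) (+-identityˡ x)
          }
        ; inverse = -‿inverseˡ , λ x → trans (+-comm x _) (-‿inverseˡ x)
        ; ⁻¹-cong = -‿cong
        }
      ; comm = +-comm
      }
    ; *-cong     = *-cong
    ; *-assoc    = *-assoc
    ; *-identity = *-identityˡ , λ x → trans (sym (con-central 1ℚ x)) (*-identityˡ x)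
    ; distrib    = distribˡ , distribʳ
    }
  }

R-module : ℕ → LeftModule ℚₚ.+-*-ring 0ℓ 0ℓ
R-module n = record
  { Carrierᴹ = Carrier
  ; _≈ᴹ_     = _≈_
  ; _+ᴹ_     = _+_
  ; _*ₗ_     = λ q x → con q * x
  ; 0ᴹ       = 0#
  ; -ᴹ_      = -_
  ; isLeftModule = record
    { isLeftSemimodule = record
      { +ᴹ-isCommutativeMonoid = +-isCommutativeMonoid
      ; isPreleftSemimodule    = record
        { *ₗ-cong      = λ p≡q x≈y → *-cong (reflexive (cong con p≡q)) x≈y
        ; *ₗ-zeroˡ     = zeroˡ
        ; *ₗ-distribʳ  = λ x p q → trans (*-cong (con-+ p q) refl) (distribʳ x (con p) (con q))
        ; *ₗ-identityˡ = *-identityˡ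
        ; *ₗ-assoc     = λ p q x → trans (*-cong (con-* p q) refl) (*-assoc (con p) (con q) x)
        ; *ₗ-zeroʳ     = λ q → zeroʳ (con q)
        ; *ₗ-distribˡ  = λ q → distribˡ (con q)
        }
      }
    ; -ᴹ‿cong    = -‿cong
    ; -ᴹ‿inverse = -‿inverse
    }
  }
  where
  open Ring (R n) using (Carrier; 0#; +-isCommutativeMonoid; reflexive; zeroˡ; zeroʳ; -‿inverse)

------------------------------------------------------------------------
-- Ballot sequences

ones : List Bit → ℕ
ones u = sum (map toℕ u)

-- The condition a₁ + ⋯ + aᵣ > r/2, cleared of its denominator.
BreaksBallot : ∀ {n} → Pred (Vec Bit n) 0ℓ
BreaksBallot {n} α =
  ∃[ r ] 1 ≤ r × r ≤ n × r < 2 ℕ.* ones (take r (toList α))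

------------------------------------------------------------------------
-- The elements F and G and the ideal I

subsets : ∀ n → List (Subset n)
subsets zero    = Vec.[] ∷ []
subsets (suc n) = map (outside Vec.∷_) (subsets n) ++ map (inside Vec.∷_) (subsets n)

module _ {n : ℕ} where
  open Ring (R n) using (0#; 1#; _-_; semiring)
  open Exp semiring using (_^_)

  -- allFin lists the indices in increasing order.
  θ⟨_⟩ : Subset n → Expr n
  θ⟨ A ⟩ = foldr _*_ 1# (map θ (filter (_∈? A) (allFin n)))

  F : ℕ → Expr n
  F r = foldr _+_ 0# (map θ⟨_⟩ (filter (λ A → ∣ A ∣ ≟ r) (subsets n)))

  -- G-aux v s is G at the string u 1ˢ 0ⁿ⁻ᵏ⁻ˢ, where v lists the letters
  -- of the length-k string u, each paired with its position, from last
  -- to first.  A final 1 of u joins the block 1ˢ; a final 0 joins the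
  -- block of trailing zeros if s = 0, and is otherwise the 0 to which
  -- the recursion for G applies.
  G-aux : List (Fin n × Bit) → ℕ → Expr n
  G-aux []             s       = F s
  G-aux ((k , 1F) ∷ v) s       = G-aux v (suc s)
  G-aux ((k , 0F) ∷ v) zero    = G-aux v zero
  G-aux ((k , 0F) ∷ v) (suc s) =
    G-aux v (suc s) - (- 1#) ^ ones (map proj₂ v) * θ k * G-aux v s

  G : Vec Bit n → Expr n
  G α = G-aux (reverse (toList (Vec.zip (Vec.allFin n) α))) zero

I : ∀ n → Pred (Expr n) 0ℓ
I n = Ideal⟨_⟩ (R n) (λ x → ∃[ r ] 1 ≤ r × r ≤ n × x ≡ F r)

{-# OPTIONS --safe #-}
module Submission where

-- Identify R n with its space of coefficients.  Splitting off the first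
-- letter, G (0 α) = G α, while G (1 α) is θ₁ times G α (in the variables
-- θ₂, θ₃, …) plus terms without θ₁.  So G α has leading term θ_α in the
-- lexicographic order, and all the G α are independent.  If α breaks the
-- ballot condition, then every F s to which G α expands has s ≥ 1, so that
-- G α lies in the ideal.
--
-- Subtracting multiples of the G α with α breaking, every element of the
-- ideal is reduced to 0, provided that no element of the ideal has a leading
-- term θ_α with α ballot.  To see this, send y to its coefficient of θᵢ₊₁
-- minus its coefficient of θᵢ (with these two variables moved to the front).
-- This commutes up to sign with multiplication by F r, so it maps the ideal
-- of R n to that of R (n - 2).  Applied at the first 1 of α, which for a
-- ballot α comes right after a 0, it deletes this pair 01 from the leading
-- term.  In the end α consists of zeros, but the ideal has no constant terms.

open import Defs
open import Data.Nat using (ℕ; _≤_)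
open import Algebra.Bundles using (AbelianGroup; CommutativeMonoid; Ring)
import Algebra.Properties.AbelianGroup as AbelianGroupProperties
import Algebra.Properties.CommutativeSemigroup as CommutativeSemigroupProperties
import Algebra.Properties.Ring as RingProperties
import Algebra.Properties.Semiring.Exp as Exp
open import Data.Bool.Base using (true; false; T; if_then_else_)
open import Data.Digit using (Bit)
open import Data.Fin.Base using (Fin; zero; suc; toℕ)
open import Data.Fin.Patterns using (0F; 1F)
open import Data.Fin.Properties as Finₚ using (0≢1+n; suc-injective)
open import Data.Fin.Subset using (Subset; inside; outside; ∣_∣)
open import Data.Fin.Subset.Properties using (_∈?_)
open import Data.List.Base as List
  using (List; []; _∷_; _++_; allFin; drop; filter; foldr; length; map; reverse; take)
open import Data.List.Membership.DecPropositional using () renaming (_∈?_ to _∈[_]?_)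
open import Data.List.Membership.Propositional using (_∈_)
import Data.List.Properties as Listₚ
import Data.List.Relation.Binary.Permutation.Propositional.Properties as Permₚ
open import Data.List.Relation.Unary.All as All using (All; []; _∷_)
open import Data.List.Relation.Unary.All.Properties using (¬Any⇒All¬)
open import Data.List.Relation.Unary.AllPairs using ([]; _∷_)
open import Data.List.Relation.Unary.Any using (here; there)
open import Data.List.Relation.Unary.Unique.Propositional using (Unique)
open import Data.Nat.Base as ℕ using (zero; suc; z≤n; s≤s; s≤s⁻¹; _<_; _≡ᵇ_)
open import Data.Nat.ListAction.Properties using (sum-↭)
import Data.Nat.Properties as ℕₚ
open import Data.Product.Base as Product using (∃-syntax; _×_; _,_; proj₁; proj₂)
open import Data.Rational.Base as ℚ using (ℚ; 0ℚ; 1ℚ)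
import Data.Rational.Properties as ℚₚ
open import Data.Sum.Base using (_⊎_; inj₁; inj₂)
open import Data.Unit.Base using (⊤; tt)
open import Data.Vec.Base as Vec using (Vec; []; _∷_; toList)
import Data.Vec.Properties as Vecₚ
open import Function.Base using (_∘_; id)
open import Function.Definitions using (Injective)
open import Level using (0ℓ)
open import Relation.Binary.Definitions using (DecidableEquality)
open import Relation.Binary.PropositionalEquality as ≡
  using (_≡_; _≢_; cong; cong₂; module ≡-Reasoning)
import Relation.Binary.Reasoning.Setoid as SetoidReasoning
open import Relation.Nullary.Decidable using (yes; no; does)
open import Relation.Nullary.Negation using (contradiction)
open import Relation.Unary using (Pred)

private
  variable
    m n : ℕ

-- Coefficients

-- The exterior algebra as a vector space: a +θ b stands for a + θ₁ b,
-- where a and b involve the variables θ₂, θ₃, … only.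
infix 5 _+θ_

data Λ : ℕ → Set where
  scalar : ℚ → Λ zero
  _+θ_   : Λ n → Λ n → Λ (suc n)

infixl 6 _⊕_
infixr 7 _∙_
infix  8 ⊖_

0Λ : Λ n
0Λ {zero}  = scalar 0ℚ
0Λ {suc n} = 0Λ +θ 0Λ

1Λ : Λ n
1Λ {zero}  = scalar 1ℚ
1Λ {suc n} = 1Λ +θ 0Λ

_⊕_ : Λ n → Λ n → Λ n
scalar p ⊕ scalar q = scalar (p ℚ.+ q)
(a +θ b) ⊕ (c +θ d) = (a ⊕ c) +θ (b ⊕ d)

⊖_ : Λ n → Λ n
⊖ scalar q = scalar (ℚ.- q)
⊖ (a +θ b) = (⊖ a) +θ (⊖ b)

_∙_ : ℚ → Λ n → Λ n
q ∙ scalar p = scalar (q ℚ.* p)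
q ∙ (a +θ b) = (q ∙ a) +θ (q ∙ b)

⊕-assoc : (x y z : Λ n) → (x ⊕ y) ⊕ z ≡ x ⊕ (y ⊕ z)
⊕-assoc (scalar p) (scalar q) (scalar r) = cong scalar (ℚₚ.+-assoc p q r)
⊕-assoc (a +θ b) (c +θ d) (e +θ f) = cong₂ _+θ_ (⊕-assoc a c e) (⊕-assoc b d f)

⊕-comm : (x y : Λ n) → x ⊕ y ≡ y ⊕ x
⊕-comm (scalar p) (scalar q) = cong scalar (ℚₚ.+-comm p q)
⊕-comm (a +θ b) (c +θ d) = cong₂ _+θ_ (⊕-comm a c) (⊕-comm b d)

⊕-identityˡ : (x : Λ n) → 0Λ ⊕ x ≡ x
⊕-identityˡ (scalar q) = cong scalar (ℚₚ.+-identityˡ q)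
⊕-identityˡ (a +θ b) = cong₂ _+θ_ (⊕-identityˡ a) (⊕-identityˡ b)

⊖-inverseˡ : (x : Λ n) → ⊖ x ⊕ x ≡ 0Λ
⊖-inverseˡ (scalar q) = cong scalar (ℚₚ.+-inverseˡ q)
⊖-inverseˡ (a +θ b) = cong₂ _+θ_ (⊖-inverseˡ a) (⊖-inverseˡ b)

Λ-abelianGroup : ℕ → AbelianGroup 0ℓ 0ℓ
Λ-abelianGroup n = record
  { Carrier = Λ n
  ; _≈_     = _≡_
  ; _∙_     = _⊕_
  ; ε       = 0Λ
  ; _⁻¹     = ⊖_
  ; isAbelianGroup = record
    { isGroup = record
      { isMonoid = record
        { isSemigroup = record
          { isMagma = record { isEquivalence = ≡.isEquivalence ; ∙-cong = cong₂ _⊕_ }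
          ; assoc   = ⊕-assoc
          }
        ; identity = ⊕-identityˡ , λ x → ≡.trans (⊕-comm x 0Λ) (⊕-identityˡ x)
        }
      ; inverse = ⊖-inverseˡ , λ x → ≡.trans (⊕-comm x (⊖ x)) (⊖-inverseˡ x)
      ; ⁻¹-cong = cong ⊖_
      }
    ; comm = ⊕-comm
    }
  }

module _ {n : ℕ} where
  open AbelianGroup (Λ-abelianGroup n) public
    using () renaming (identityʳ to ⊕-identityʳ; inverseʳ to ⊖-inverseʳ)
  open AbelianGroupProperties (Λ-abelianGroup n) public
    using ()
    renaming ( ⁻¹-involutive to ⊖-involutive; ε⁻¹≈ε to ⊖0≡0
             ; ⁻¹-∙-comm to ⊖-⊕-comm; inverseˡ-unique to ⊖-unique)
  open CommutativeSemigroupProperties (AbelianGroup.commutativeSemigroup (Λ-abelianGroup n)) public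
    using () renaming (interchange to ⊕-interchange)

∙-distribˡ : ∀ q (x y : Λ n) → q ∙ (x ⊕ y) ≡ q ∙ x ⊕ q ∙ y
∙-distribˡ q (scalar x) (scalar y) = cong scalar (ℚₚ.*-distribˡ-+ q x y)
∙-distribˡ q (a +θ b) (c +θ d) = cong₂ _+θ_ (∙-distribˡ q a c) (∙-distribˡ q b d)

∙-distribʳ : ∀ p q (x : Λ n) → (p ℚ.+ q) ∙ x ≡ p ∙ x ⊕ q ∙ x
∙-distribʳ p q (scalar x) = cong scalar (ℚₚ.*-distribʳ-+ x p q)
∙-distribʳ p q (a +θ b) = cong₂ _+θ_ (∙-distribʳ p q a) (∙-distribʳ p q b)

∙-assoc : ∀ p q (x : Λ n) → (p ℚ.* q) ∙ x ≡ p ∙ (q ∙ x)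
∙-assoc p q (scalar x) = cong scalar (ℚₚ.*-assoc p q x)
∙-assoc p q (a +θ b) = cong₂ _+θ_ (∙-assoc p q a) (∙-assoc p q b)

∙-identityˡ : (x : Λ n) → 1ℚ ∙ x ≡ x
∙-identityˡ (scalar x) = cong scalar (ℚₚ.*-identityˡ x)
∙-identityˡ (a +θ b) = cong₂ _+θ_ (∙-identityˡ a) (∙-identityˡ b)

∙-zeroˡ : (x : Λ n) → 0ℚ ∙ x ≡ 0Λ
∙-zeroˡ (scalar x) = cong scalar (ℚₚ.*-zeroˡ x)
∙-zeroˡ (a +θ b) = cong₂ _+θ_ (∙-zeroˡ a) (∙-zeroˡ b)

∙-comm : ∀ p q (x : Λ n) → p ∙ (q ∙ x) ≡ q ∙ (p ∙ x)
∙-comm p q x = begin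
  p ∙ (q ∙ x)    ≡⟨ ∙-assoc p q x ⟨
  (p ℚ.* q) ∙ x  ≡⟨ cong (_∙ x) (ℚₚ.*-comm p q) ⟩
  (q ℚ.* p) ∙ x  ≡⟨ ∙-assoc q p x ⟩
  q ∙ (p ∙ x)    ∎
  where open ≡-Reasoning

-- Linear maps between coefficient spaces

record Linear (f : Λ m → Λ n) : Set where
  field
    ⊕-homo : ∀ x y → f (x ⊕ y) ≡ f x ⊕ f y
    ∙-homo : ∀ q x → f (q ∙ x) ≡ q ∙ f x

  0-homo : f 0Λ ≡ 0Λ
  0-homo = begin
    f 0Λ         ≡⟨ cong f (∙-zeroˡ 0Λ) ⟨
    f (0ℚ ∙ 0Λ)  ≡⟨ ∙-homo 0ℚ 0Λ ⟩
    0ℚ ∙ f 0Λ    ≡⟨ ∙-zeroˡ (f 0Λ) ⟩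
    0Λ           ∎
    where open ≡-Reasoning

  ⊖-homo : ∀ x → f (⊖ x) ≡ ⊖ f x
  ⊖-homo x = ⊖-unique _ _ (begin
    f (⊖ x) ⊕ f x  ≡⟨ ⊕-homo (⊖ x) x ⟨
    f (⊖ x ⊕ x)    ≡⟨ cong f (⊖-inverseˡ x) ⟩
    f 0Λ           ≡⟨ 0-homo ⟩
    0Λ             ∎)
    where open ≡-Reasoning

open Linear

∘-linear : ∀ {k} {f : Λ m → Λ n} {g : Λ k → Λ m} → Linear f → Linear g → Linear (f ∘ g)
∘-linear {f = f} F G = record
  { ⊕-homo = λ x y → ≡.trans (cong f (⊕-homo G x y)) (⊕-homo F _ _)
  ; ∙-homo = λ q x → ≡.trans (cong f (∙-homo G q x)) (∙-homo F _ _)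
  }

id-linear : Linear (id {A = Λ n})
id-linear = record { ⊕-homo = λ _ _ → ≡.refl ; ∙-homo = λ _ _ → ≡.refl }

∙-linear : ∀ q → Linear (_∙_ {n} q)
∙-linear q = record { ⊕-homo = ∙-distribˡ q ; ∙-homo = λ p → ∙-comm q p }

⊕-linear : {f g : Λ m → Λ n} → Linear f → Linear g → Linear (λ x → f x ⊕ g x)
⊕-linear F G = record
  { ⊕-homo = λ x y → ≡.trans (cong₂ _⊕_ (⊕-homo F x y) (⊕-homo G x y)) (⊕-interchange _ _ _ _)
  ; ∙-homo = λ q x → ≡.trans (cong₂ _⊕_ (∙-homo F q x) (∙-homo G q x)) (≡.sym (∙-distribˡ q _ _))
  }

⊖-∙-comm : ∀ q (x : Λ n) → ⊖ (q ∙ x) ≡ q ∙ (⊖ x)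
⊖-∙-comm q x = ≡.sym (⊖-homo (∙-linear q) x)

⊖-linear : Linear {n} ⊖_
⊖-linear = record { ⊕-homo = λ x y → ≡.sym (⊖-⊕-comm x y) ; ∙-homo = λ q x → ⊖-∙-comm q x }

-- The sign comes from moving an odd operator T past θ₁.
up : (Λ m → Λ n) → Λ (suc m) → Λ (suc n)
up T (a +θ b) = T a +θ ⊖ T b

up-linear : {T : Λ m → Λ n} → Linear T → Linear (up T)
up-linear L = record
  { ⊕-homo = λ { (a +θ b) (c +θ d) →
      cong₂ _+θ_ (⊕-homo L a c) (⊕-homo (∘-linear ⊖-linear L) b d) }
  ; ∙-homo = λ { q (a +θ b) →
      cong₂ _+θ_ (∙-homo L q a) (∙-homo (∘-linear ⊖-linear L) q b) }
  }

θ₁* : Λ (suc n) → Λ (suc n)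
θ₁* (a +θ b) = 0Λ +θ a

θ₁*-linear : Linear (θ₁* {n})
θ₁*-linear = record
  { ⊕-homo = λ { (a +θ b) (c +θ d) → cong₂ _+θ_ (≡.sym (⊕-identityˡ 0Λ)) ≡.refl }
  ; ∙-homo = λ { q (a +θ b) → cong₂ _+θ_ (≡.sym (0-homo (∙-linear q))) ≡.refl }
  }

θ* : Fin n → Λ n → Λ n
θ* zero    = θ₁*
θ* (suc i) = up (θ* i)

θ*-linear : (i : Fin n) → Linear (θ* i)
θ*-linear zero    = θ₁*-linear
θ*-linear (suc i) = up-linear (θ*-linear i)

θ*-square : ∀ (i : Fin n) w → θ* i (θ* i w) ≡ 0Λ
θ*-square zero    (a +θ b) = ≡.refl
θ*-square (suc i) (a +θ b) = cong₂ _+θ_ (θ*-square i a) (begin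
  ⊖ θ* i (⊖ θ* i b)    ≡⟨ cong ⊖_ (⊖-homo (θ*-linear i) _) ⟩
  ⊖ ⊖ θ* i (θ* i b)    ≡⟨ cong (λ x → ⊖ ⊖ x) (θ*-square i b) ⟩
  ⊖ ⊖ 0Λ               ≡⟨ ⊖-involutive 0Λ ⟩
  0Λ                   ∎)
  where open ≡-Reasoning

θ*-anticomm : ∀ {i j : Fin n} → i ≢ j → ∀ w → θ* i (θ* j w) ≡ ⊖ θ* j (θ* i w)
θ*-anticomm {i = zero}  {zero}  i≢j w = contradiction ≡.refl i≢j
θ*-anticomm {i = zero}  {suc j} i≢j (a +θ b) =
  cong₂ _+θ_ (≡.sym (≡.trans (cong ⊖_ (0-homo (θ*-linear j))) ⊖0≡0)) (≡.sym (⊖-involutive _))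
θ*-anticomm {i = suc i} {zero}  i≢j (a +θ b) =
  cong₂ _+θ_ (≡.trans (0-homo (θ*-linear i)) (≡.sym ⊖0≡0)) ≡.refl
θ*-anticomm {i = suc i} {suc j} i≢j (a +θ b) =
  cong₂ _+θ_ (anticomm a) (cong ⊖_ (begin
    θ* i (⊖ θ* j b)    ≡⟨ ⊖-homo (θ*-linear i) _ ⟩
    ⊖ θ* i (θ* j b)    ≡⟨ cong ⊖_ (anticomm b) ⟩
    ⊖ ⊖ θ* j (θ* i b)  ≡⟨ cong ⊖_ (⊖-homo (θ*-linear j) _) ⟨
    ⊖ θ* j (⊖ θ* i b)  ∎))
  where
  open ≡-Reasoning
  anticomm = θ*-anticomm (i≢j ∘ cong suc)

-- The action of expressions on coefficients

-- The ring acts by left multiplication, so that no product on `Λ n` has to be defined: products of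
-- expressions become compositions. The coefficients of `x` are `⟦ x ⟧ 1Λ`.
⟦_⟧ : Expr n → Λ n → Λ n
⟦ con q ⟧ w = q ∙ w
⟦ θ i ⟧   w = θ* i w
⟦ x + y ⟧ w = ⟦ x ⟧ w ⊕ ⟦ y ⟧ w
⟦ x * y ⟧ w = ⟦ x ⟧ (⟦ y ⟧ w)
⟦ - x ⟧   w = ⊖ ⟦ x ⟧ w

⟦⟧-linear : (x : Expr n) → Linear ⟦ x ⟧
⟦⟧-linear (con q) = ∙-linear q
⟦⟧-linear (θ i)   = θ*-linear i
⟦⟧-linear (x + y) = ⊕-linear (⟦⟧-linear x) (⟦⟧-linear y)
⟦⟧-linear (x * y) = ∘-linear (⟦⟧-linear x) (⟦⟧-linear y)
⟦⟧-linear (- x)   = ∘-linear ⊖-linear (⟦⟧-linear x)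

-- Every relation of the presentation holds for the operators; `distribˡ` and `con-central` are
-- exactly their linearity.
⟦⟧-cong : {x y : Expr n} → x ≈ y → ∀ w → ⟦ x ⟧ w ≡ ⟦ y ⟧ w
⟦⟧-cong refl w = ≡.refl
⟦⟧-cong (sym p) w = ≡.sym (⟦⟧-cong p w)
⟦⟧-cong (trans p q) w = ≡.trans (⟦⟧-cong p w) (⟦⟧-cong q w)
⟦⟧-cong (+-cong p q) w = cong₂ _⊕_ (⟦⟧-cong p w) (⟦⟧-cong q w)
⟦⟧-cong (*-cong {x} p q) w = ≡.trans (cong ⟦ x ⟧ (⟦⟧-cong q w)) (⟦⟧-cong p _)
⟦⟧-cong (-‿cong p) w = cong ⊖_ (⟦⟧-cong p w)
⟦⟧-cong (+-assoc x y z) w = ⊕-assoc _ _ _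
⟦⟧-cong (+-comm x y) w = ⊕-comm _ _
⟦⟧-cong (+-identityˡ x) w = ≡.trans (cong₂ _⊕_ (∙-zeroˡ w) ≡.refl) (⊕-identityˡ _)
⟦⟧-cong (-‿inverseˡ x) w = ≡.trans (⊖-inverseˡ _) (≡.sym (∙-zeroˡ w))
⟦⟧-cong (*-assoc x y z) w = ≡.refl
⟦⟧-cong (*-identityˡ x) w = ∙-identityˡ _
⟦⟧-cong (distribˡ x y z) w = ⊕-homo (⟦⟧-linear x) _ _
⟦⟧-cong (distribʳ x y z) w = ≡.refl
⟦⟧-cong (con-+ p q) w = ∙-distribʳ p q w
⟦⟧-cong (con-* p q) w = ∙-assoc p q w
⟦⟧-cong (con-central q x) w = ≡.sym (∙-homo (⟦⟧-linear x) q w)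
⟦⟧-cong (θ-anticomm i≢j) w = θ*-anticomm i≢j w
⟦⟧-cong (θ-square i) w = ≡.trans (θ*-square i w) (≡.sym (∙-zeroˡ w))

-- From coefficients back to expressions

module _ {n : ℕ} where
  open Ring (R n)
    using (setoid; zeroʳ; *-identityʳ; +-commutativeMonoid; +-congˡ; *-congˡ; *-congʳ)
    renaming (+-identityʳ to x+0≈x)
  open RingProperties (R n)
    using (+-inverseˡ-unique; -‿distribˡ-*; -‿distribʳ-*)
  open CommutativeSemigroupProperties
    (CommutativeMonoid.commutativeSemigroup +-commutativeMonoid) using (interchange)
  open SetoidReasoning setoid

  -- The renaming `σ` keeps the target ring fixed while the recursion drops the first variable.
  reify : (Fin m → Fin n) → Λ m → Expr n
  reify σ (scalar q) = con q
  reify σ (a +θ b)   = reify (σ ∘ suc) a + θ (σ zero) * reify (σ ∘ suc) b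

  reify-0 : (σ : Fin m → Fin n) → reify σ 0Λ ≈ con 0ℚ
  reify-0 {zero}  σ = refl
  reify-0 {suc m} σ = begin
    reify _ 0Λ + θ _ * reify _ 0Λ  ≈⟨ +-cong (reify-0 _) (*-congˡ (reify-0 _)) ⟩
    con 0ℚ + θ _ * con 0ℚ          ≈⟨ +-identityˡ _ ⟩
    θ _ * con 0ℚ                   ≈⟨ zeroʳ _ ⟩
    con 0ℚ                         ∎

  reify-1 : (σ : Fin m → Fin n) → reify σ 1Λ ≈ con 1ℚ
  reify-1 {zero}  σ = refl
  reify-1 {suc m} σ = begin
    reify _ 1Λ + θ _ * reify _ 0Λ  ≈⟨ +-cong (reify-1 _) (*-congˡ (reify-0 _)) ⟩
    con 1ℚ + θ _ * con 0ℚ          ≈⟨ +-congˡ (zeroʳ _) ⟩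
    con 1ℚ + con 0ℚ                ≈⟨ x+0≈x _ ⟩
    con 1ℚ                         ∎

  reify-⊕ : ∀ (σ : Fin m → Fin n) x y → reify σ (x ⊕ y) ≈ reify σ x + reify σ y
  reify-⊕ σ (scalar p) (scalar q) = con-+ p q
  reify-⊕ σ (a +θ b) (c +θ d) = begin
    reify _ (a ⊕ c) + t * reify _ (b ⊕ d)
      ≈⟨ +-cong (reify-⊕ _ a c) (*-congˡ (reify-⊕ _ b d)) ⟩
    reify _ a + reify _ c + t * (reify _ b + reify _ d)
      ≈⟨ +-congˡ (distribˡ _ _ _) ⟩
    reify _ a + reify _ c + (t * reify _ b + t * reify _ d)
      ≈⟨ interchange _ _ _ _ ⟩
    reify _ a + t * reify _ b + (reify _ c + t * reify _ d) ∎
    where t = θ (σ zero)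

  reify-⊖ : ∀ (σ : Fin m → Fin n) x → reify σ (⊖ x) ≈ - reify σ x
  reify-⊖ σ x = +-inverseˡ-unique _ _ (begin
    reify σ (⊖ x) + reify σ x  ≈⟨ reify-⊕ σ (⊖ x) x ⟨
    reify σ (⊖ x ⊕ x)          ≡⟨ cong (reify σ) (⊖-inverseˡ x) ⟩
    reify σ 0Λ                 ≈⟨ reify-0 σ ⟩
    con 0ℚ                     ∎)

  reify-∙ : ∀ (σ : Fin m → Fin n) q x → reify σ (q ∙ x) ≈ con q * reify σ x
  reify-∙ σ q (scalar x) = con-* q x
  reify-∙ σ q (a +θ b) = begin
    reify _ (q ∙ a) + t * reify _ (q ∙ b)
      ≈⟨ +-cong (reify-∙ _ q a) (*-congˡ (reify-∙ _ q b)) ⟩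
    con q * reify _ a + t * (con q * reify _ b)
      ≈⟨ +-congˡ (*-assoc t _ _) ⟨
    con q * reify _ a + t * con q * reify _ b
      ≈⟨ +-congˡ (*-congʳ (con-central q t)) ⟨
    con q * reify _ a + con q * t * reify _ b
      ≈⟨ +-congˡ (*-assoc _ t _) ⟩
    con q * reify _ a + con q * (t * reify _ b)
      ≈⟨ distribˡ _ _ _ ⟨
    con q * (reify _ a + t * reify _ b) ∎
    where t = θ (σ zero)

  -- For `zero`, the square of the variable kills the second part. For `suc i`, injectivity of `σ`
  -- keeps the two variables distinct, so they anticommute, and the resulting sign is the one built
  -- into `up`.
  reify-θ* : ∀ (σ : Fin m → Fin n) → Injective _≡_ _≡_ σ →
             ∀ i w → reify σ (θ* i w) ≈ θ (σ i) * reify σ w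
  reify-θ* σ inj zero (a +θ b) = begin
    reify _ 0Λ + t * reify _ a         ≈⟨ +-cong (reify-0 _) refl ⟩
    con 0ℚ + t * reify _ a             ≈⟨ +-comm _ _ ⟩
    t * reify _ a + con 0ℚ             ≈⟨ +-congˡ (Ring.zeroˡ (R n) _) ⟨
    t * reify _ a + con 0ℚ * reify _ b ≈⟨ +-congˡ (*-congʳ (θ-square _)) ⟨
    t * reify _ a + t * t * reify _ b  ≈⟨ +-congˡ (*-assoc _ _ _) ⟩
    t * reify _ a + t * (t * reify _ b) ≈⟨ distribˡ _ _ _ ⟨
    t * (reify _ a + t * reify _ b)    ∎
    where t = θ (σ zero)
  reify-θ* σ inj (suc i) (a +θ b) = begin
    reify _ (θ* i a) + t * reify _ (⊖ θ* i b)
      ≈⟨ +-cong (ih a) (*-congˡ (trans (reify-⊖ _ _) (-‿cong (ih b)))) ⟩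
    u * reify _ a + t * - (u * reify _ b)
      ≈⟨ +-congˡ (-‿distribʳ-* t _) ⟨
    u * reify _ a + - (t * (u * reify _ b))
      ≈⟨ +-congˡ (-‿cong (*-assoc t u _)) ⟨
    u * reify _ a + - (t * u * reify _ b)
      ≈⟨ +-congˡ (-‿distribˡ-* _ _) ⟩
    u * reify _ a + - (t * u) * reify _ b
      ≈⟨ +-congˡ (*-congʳ (θ-anticomm (0≢1+n ∘ ≡.sym ∘ inj))) ⟨
    u * reify _ a + u * t * reify _ b
      ≈⟨ +-congˡ (*-assoc u t _) ⟩
    u * reify _ a + u * (t * reify _ b)
      ≈⟨ distribˡ _ _ _ ⟨
    u * (reify _ a + t * reify _ b) ∎
    where
    t = θ (σ zero)
    u = θ (σ (suc i))
    ih = reify-θ* (σ ∘ suc) (suc-injective ∘ inj) i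

  reify-⟦⟧ : (x : Expr n) (w : Λ n) → reify id (⟦ x ⟧ w) ≈ x * reify id w
  reify-⟦⟧ (con q) w = reify-∙ id q w
  reify-⟦⟧ (θ i)   w = reify-θ* id id i w
  reify-⟦⟧ (x + y) w = begin
    reify id (⟦ x ⟧ w ⊕ ⟦ y ⟧ w)            ≈⟨ reify-⊕ id _ _ ⟩
    reify id (⟦ x ⟧ w) + reify id (⟦ y ⟧ w)  ≈⟨ +-cong (reify-⟦⟧ x w) (reify-⟦⟧ y w) ⟩
    x * reify id w + y * reify id w          ≈⟨ distribʳ _ x y ⟨
    (x + y) * reify id w                     ∎
  reify-⟦⟧ (x * y) w = begin
    reify id (⟦ x ⟧ (⟦ y ⟧ w))  ≈⟨ reify-⟦⟧ x _ ⟩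
    x * reify id (⟦ y ⟧ w)      ≈⟨ *-congˡ (reify-⟦⟧ y w) ⟩
    x * (y * reify id w)        ≈⟨ *-assoc x y _ ⟨
    x * y * reify id w          ∎
  reify-⟦⟧ (- x) w = begin
    reify id (⊖ ⟦ x ⟧ w)  ≈⟨ reify-⊖ id _ ⟩
    - reify id (⟦ x ⟧ w)  ≈⟨ -‿cong (reify-⟦⟧ x w) ⟩
    - (x * reify id w)    ≈⟨ -‿distribˡ-* x _ ⟩
    - x * reify id w      ∎

  reify-⟦⟧1 : (x : Expr n) → reify id (⟦ x ⟧ 1Λ) ≈ x
  reify-⟦⟧1 x = begin
    reify id (⟦ x ⟧ 1Λ)  ≈⟨ reify-⟦⟧ x 1Λ ⟩
    x * reify id 1Λ      ≈⟨ *-congˡ (reify-1 id) ⟩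
    x * con 1ℚ           ≈⟨ *-identityʳ x ⟩
    x                    ∎

  -- `reify id` turns the action on `1Λ` into multiplication by 1, so it recovers an expression from
  -- its coefficients.
  ⟦⟧-injective : {x y : Expr n} → ⟦ x ⟧ 1Λ ≡ ⟦ y ⟧ 1Λ → x ≈ y
  ⟦⟧-injective {x} {y} eq = begin
    x                    ≈⟨ reify-⟦⟧1 x ⟨
    reify id (⟦ x ⟧ 1Λ)  ≡⟨ cong (reify id) eq ⟩
    reify id (⟦ y ⟧ 1Λ)  ≈⟨ reify-⟦⟧1 y ⟩
    y                    ∎

-- Multiplication by F r

signed : ℕ → Λ n → Λ n
signed zero    x = x
signed (suc k) x = ⊖ signed k x

signed-linear : ∀ k → Linear (signed {n} k)
signed-linear zero    = id-linear
signed-linear (suc k) = ∘-linear ⊖-linear (signed-linear k)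

signed-+θ : ∀ k (a b : Λ n) → signed k (a +θ b) ≡ signed k a +θ signed k b
signed-+θ zero    a b = ≡.refl
signed-+θ (suc k) a b = cong ⊖_ (signed-+θ k a b)

signed-homo : {T : Λ m → Λ n} → Linear T → ∀ k x → T (signed k x) ≡ signed k (T x)
signed-homo L zero    x = ≡.refl
signed-homo L (suc k) x = ≡.trans (⊖-homo L _) (cong ⊖_ (signed-homo L k x))

signed-involutive : ∀ k (x : Λ n) → signed k (signed k x) ≡ x
signed-involutive zero    x = ≡.refl
signed-involutive (suc k) x = begin
  ⊖ signed k (⊖ signed k x)  ≡⟨ cong ⊖_ (⊖-homo (signed-linear k) _) ⟩
  ⊖ ⊖ signed k (signed k x)  ≡⟨ ⊖-involutive _ ⟩
  signed k (signed k x)      ≡⟨ signed-involutive k x ⟩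
  x                          ∎
  where open ≡-Reasoning

-- Left multiplication by `F r`. With F′ denoting the same sums in θ₂, θ₃, ..., it comes from Fᵣ =
-- F′ᵣ + θ₁ F′ᵣ₋₁: the second summand kills θ₁ b, and F′ᵣ passes θ₁ with the sign (-1)ʳ.
F* : ℕ → Λ n → Λ n
F* zero    w          = w
F* (suc r) (scalar q) = 0Λ
F* (suc r) (a +θ b)   = F* (suc r) a +θ (F* r a ⊕ signed (suc r) (F* (suc r) b))

F*-linear : ∀ r → Linear (F* {n} r)
F*-linear zero    = id-linear
F*-linear (suc r) = record
  { ⊕-homo = λ { (scalar _) (scalar _) → ≡.sym (⊕-identityˡ 0Λ)
               ; (a +θ b) (c +θ d) → cong₂ _+θ_ (⊕-homo (F*-linear (suc r)) a c) (begin
      F* r (a ⊕ c) ⊕ s (F* (suc r) (b ⊕ d))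
        ≡⟨ cong₂ _⊕_ (⊕-homo (F*-linear r) a c) (⊕-homo sF b d) ⟩
      (F* r a ⊕ F* r c) ⊕ (s (F* (suc r) b) ⊕ s (F* (suc r) d))
        ≡⟨ ⊕-interchange _ _ _ _ ⟩
      (F* r a ⊕ s (F* (suc r) b)) ⊕ (F* r c ⊕ s (F* (suc r) d)) ∎) }
  ; ∙-homo = λ { q (scalar _) → ≡.sym (0-homo (∙-linear q))
               ; q (a +θ b) → cong₂ _+θ_ (∙-homo (F*-linear (suc r)) q a) (begin
      F* r (q ∙ a) ⊕ s (F* (suc r) (q ∙ b))
        ≡⟨ cong₂ _⊕_ (∙-homo (F*-linear r) q a) (∙-homo sF q b) ⟩
      q ∙ F* r a ⊕ q ∙ s (F* (suc r) b)
        ≡⟨ ∙-distribˡ q _ _ ⟨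
      q ∙ (F* r a ⊕ s (F* (suc r) b)) ∎) }
  }
  where
  open ≡-Reasoning
  s : Λ n → Λ n
  s = signed (suc r)
  sF : Linear (λ (x : Λ n) → s (F* (suc r) x))
  sF = ∘-linear (signed-linear (suc r)) (F*-linear (suc r))

-- All indices listed are successors, so the first letter `b` is never consulted.
filter-∈?-suc : ∀ b (A : Subset n) is →
                filter (_∈? (b Vec.∷ A)) (map suc is) ≡ map suc (filter (_∈? A) is)
filter-∈?-suc b A []       = ≡.refl
filter-∈?-suc b A (i ∷ is) with does (i ∈? A)
... | false = filter-∈?-suc b A is
... | true  = cong (suc i ∷_) (filter-∈?-suc b A is)

filter-∈?-tabulate-suc : ∀ b (A : Subset n) →
  filter (_∈? (b Vec.∷ A)) (List.tabulate suc) ≡ map suc (filter (_∈? A) (allFin n))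
filter-∈?-tabulate-suc b A = begin
  filter (_∈? (b Vec.∷ A)) (List.tabulate suc)      ≡⟨ cong (filter _) (Listₚ.map-tabulate id suc) ⟨
  filter (_∈? (b Vec.∷ A)) (map suc (allFin _))     ≡⟨ filter-∈?-suc b A (allFin _) ⟩
  map suc (filter (_∈? A) (allFin _))               ∎
  where open ≡-Reasoning

mutual
  length-filter-∈? : (A : Subset n) → length (filter (_∈? A) (allFin n)) ≡ ∣ A ∣
  length-filter-∈? Vec.[]            = ≡.refl
  length-filter-∈? (outside Vec.∷ A) = length-filter-∈?-tabulate-suc outside A
  length-filter-∈? (inside  Vec.∷ A) = cong suc (length-filter-∈?-tabulate-suc inside A)

  length-filter-∈?-tabulate-suc : ∀ b (A : Subset n) →
    length (filter (_∈? (b Vec.∷ A)) (List.tabulate suc)) ≡ ∣ A ∣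
  length-filter-∈?-tabulate-suc {n} b A = begin
    length (filter (_∈? (b Vec.∷ A)) (List.tabulate suc))
      ≡⟨ cong length (filter-∈?-tabulate-suc b A) ⟩
    length (map Fin.suc (filter (_∈? A) (allFin n)))
      ≡⟨ Listₚ.length-map Fin.suc (filter (_∈? A) (allFin n)) ⟩
    length (filter (_∈? A) (allFin n))
      ≡⟨ length-filter-∈? A ⟩
    ∣ A ∣ ∎
    where open ≡-Reasoning

∏ : List (Fin n) → Expr n
∏ is = foldr _*_ (con 1ℚ) (map θ is)

-- Each factor changes sign once as it passes the first variable.
∏-map-suc : ∀ (is : List (Fin n)) a b →
            ⟦ ∏ (map suc is) ⟧ (a +θ b) ≡ ⟦ ∏ is ⟧ a +θ signed (length is) (⟦ ∏ is ⟧ b)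
∏-map-suc []       a b = cong₂ _+θ_ ≡.refl ≡.refl
∏-map-suc (i ∷ is) a b = begin
  up (θ* i) (⟦ ∏ (map suc is) ⟧ (a +θ b))
    ≡⟨ cong (up (θ* i)) (∏-map-suc is a b) ⟩
  θ* i (⟦ ∏ is ⟧ a) +θ ⊖ θ* i (signed (length is) (⟦ ∏ is ⟧ b))
    ≡⟨ cong (λ x → θ* i (⟦ ∏ is ⟧ a) +θ ⊖ x) (signed-homo (θ*-linear i) (length is) _) ⟩
  θ* i (⟦ ∏ is ⟧ a) +θ ⊖ signed (length is) (θ* i (⟦ ∏ is ⟧ b)) ∎
  where open ≡-Reasoning

∏-suc-support : ∀ b (A : Subset n) x y →
  ⟦ ∏ (filter (_∈? (b Vec.∷ A)) (List.tabulate suc)) ⟧ (x +θ y) ≡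
  ⟦ θ⟨ A ⟩ ⟧ x +θ signed ∣ A ∣ (⟦ θ⟨ A ⟩ ⟧ y)
∏-suc-support b A x y = begin
  ⟦ ∏ (filter (_∈? (b Vec.∷ A)) (List.tabulate suc)) ⟧ (x +θ y)
    ≡⟨ cong (λ is → ⟦ ∏ is ⟧ (x +θ y)) (filter-∈?-tabulate-suc b A) ⟩
  ⟦ ∏ (map suc (filter (_∈? A) (allFin _))) ⟧ (x +θ y)
    ≡⟨ ∏-map-suc (filter (_∈? A) (allFin _)) x y ⟩
  ⟦ θ⟨ A ⟩ ⟧ x +θ signed (length (filter (_∈? A) (allFin _))) (⟦ θ⟨ A ⟩ ⟧ y)
    ≡⟨ cong (λ k → ⟦ θ⟨ A ⟩ ⟧ x +θ signed k (⟦ θ⟨ A ⟩ ⟧ y)) (length-filter-∈? A) ⟩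
  ⟦ θ⟨ A ⟩ ⟧ x +θ signed ∣ A ∣ (⟦ θ⟨ A ⟩ ⟧ y) ∎
  where open ≡-Reasoning

-- `F r` is `∑ r (subsets n)`; a general list of subsets allows induction on it.
∑ : ℕ → List (Subset n) → Expr n
∑ r As = foldr _+_ (con 0ℚ) (map θ⟨_⟩ (filter (λ A → ∣ A ∣ ℕₚ.≟ r) As))

∑-++ : ∀ r (As Bs : List (Subset n)) w →
       ⟦ ∑ r (As ++ Bs) ⟧ w ≡ ⟦ ∑ r As ⟧ w ⊕ ⟦ ∑ r Bs ⟧ w
∑-++ r []       Bs w = ≡.sym (≡.trans (cong₂ _⊕_ (∙-zeroˡ w) ≡.refl) (⊕-identityˡ _))
∑-++ r (A ∷ As) Bs w with does (∣ A ∣ ℕₚ.≟ r)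
... | false = ∑-++ r As Bs w
... | true  = ≡.trans (cong (⟦ θ⟨ A ⟩ ⟧ w ⊕_) (∑-++ r As Bs w)) (≡.sym (⊕-assoc _ _ _))

∑-outside : ∀ r (As : List (Subset n)) a b →
  ⟦ ∑ r (map (outside Vec.∷_) As) ⟧ (a +θ b) ≡ ⟦ ∑ r As ⟧ a +θ signed r (⟦ ∑ r As ⟧ b)
∑-outside r []       a b =
  cong₂ _+θ_ ≡.refl (begin
    0ℚ ∙ b              ≡⟨ ∙-zeroˡ b ⟩
    0Λ                  ≡⟨ 0-homo (signed-linear r) ⟨
    signed r 0Λ         ≡⟨ cong (signed r) (∙-zeroˡ b) ⟨
    signed r (0ℚ ∙ b)   ∎)
  where open ≡-Reasoning
-- The filter decides by `≡ᵇ`; `eq` is kept to turn the sign for `∣ A ∣` into the common sign for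
-- `r`.
∑-outside r (A ∷ As) a b with ∣ A ∣ ≡ᵇ r in eq
... | false = ∑-outside r As a b
... | true  = begin
  ⟦ ∏ (filter (_∈? (outside Vec.∷ A)) (List.tabulate suc)) ⟧ (a +θ b) ⊕
  ⟦ ∑ r (map (outside Vec.∷_) As) ⟧ (a +θ b)
    ≡⟨ cong₂ _⊕_ (∏-suc-support outside A a b) (∑-outside r As a b) ⟩
  (⟦ θ⟨ A ⟩ ⟧ a ⊕ ⟦ ∑ r As ⟧ a) +θ (signed ∣ A ∣ (⟦ θ⟨ A ⟩ ⟧ b) ⊕ signed r (⟦ ∑ r As ⟧ b))
    ≡⟨ cong (λ k → (⟦ θ⟨ A ⟩ ⟧ a ⊕ ⟦ ∑ r As ⟧ a) +θ (signed k _ ⊕ signed r (⟦ ∑ r As ⟧ b)))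
            (ℕₚ.≡ᵇ⇒≡ ∣ A ∣ r (≡.subst T (≡.sym eq) _)) ⟩
  (⟦ θ⟨ A ⟩ ⟧ a ⊕ ⟦ ∑ r As ⟧ a) +θ (signed r (⟦ θ⟨ A ⟩ ⟧ b) ⊕ signed r (⟦ ∑ r As ⟧ b))
    ≡⟨ cong (_ +θ_) (⊕-homo (signed-linear r) _ _) ⟨
  (⟦ θ⟨ A ⟩ ⟧ a ⊕ ⟦ ∑ r As ⟧ a) +θ signed r (⟦ θ⟨ A ⟩ ⟧ b ⊕ ⟦ ∑ r As ⟧ b) ∎
  where open ≡-Reasoning

∑-inside-zero : ∀ (As : List (Subset n)) w → ⟦ ∑ 0 (map (inside Vec.∷_) As) ⟧ w ≡ 0Λ
∑-inside-zero []       w = ∙-zeroˡ w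
∑-inside-zero (A ∷ As) w = ∑-inside-zero As w

-- Each product starts with the first variable, which annihilates the part `b` and raises the degree
-- by one.
∑-inside-suc : ∀ r (As : List (Subset n)) a b →
               ⟦ ∑ (suc r) (map (inside Vec.∷_) As) ⟧ (a +θ b) ≡ 0Λ +θ ⟦ ∑ r As ⟧ a
∑-inside-suc r []       a b = cong₂ _+θ_ (∙-zeroˡ a) (≡.trans (∙-zeroˡ b) (≡.sym (∙-zeroˡ a)))
∑-inside-suc r (A ∷ As) a b with ∣ A ∣ ≡ᵇ r
... | false = ∑-inside-suc r As a b
... | true  = ≡.trans
  (cong₂ _⊕_ (cong θ₁* (∏-suc-support inside A a b)) (∑-inside-suc r As a b))
  (cong₂ _+θ_ (⊕-identityˡ 0Λ) ≡.refl)

-- The recursion of `F*` separates the subsets without the first index from those with it, which is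
-- how `subsets` lists them.
⟦F⟧ : ∀ r (w : Λ n) → ⟦ F r ⟧ w ≡ F* r w
⟦F⟧ zero    (scalar q) = 
  ≡.trans (cong₂ _⊕_ (∙-identityˡ (scalar q)) (∙-zeroˡ (scalar q))) (⊕-identityʳ (scalar q))
⟦F⟧ (suc r) (scalar q) = cong scalar (ℚₚ.*-zeroˡ q)
⟦F⟧ {suc n} zero (a +θ b) = begin
  ⟦ F 0 ⟧ (a +θ b)
    ≡⟨ ∑-++ 0 (map (outside Vec.∷_) (subsets n)) _ (a +θ b) ⟩
  ⟦ ∑ 0 (map (outside Vec.∷_) (subsets n)) ⟧ (a +θ b) ⊕
  ⟦ ∑ 0 (map (inside Vec.∷_) (subsets n)) ⟧ (a +θ b)
    ≡⟨ cong₂ _⊕_ (∑-outside 0 (subsets n) a b) (∑-inside-zero (subsets n) (a +θ b)) ⟩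
  (⟦ F 0 ⟧ a +θ ⟦ F 0 ⟧ b) ⊕ 0Λ
    ≡⟨ ⊕-identityʳ _ ⟩
  ⟦ F 0 ⟧ a +θ ⟦ F 0 ⟧ b
    ≡⟨ cong₂ _+θ_ (⟦F⟧ 0 a) (⟦F⟧ 0 b) ⟩
  a +θ b ∎
  where open ≡-Reasoning
⟦F⟧ {suc n} (suc r) (a +θ b) = begin
  ⟦ F (suc r) ⟧ (a +θ b)
    ≡⟨ ∑-++ (suc r) (map (outside Vec.∷_) (subsets n)) _ (a +θ b) ⟩
  ⟦ ∑ (suc r) (map (outside Vec.∷_) (subsets n)) ⟧ (a +θ b) ⊕
  ⟦ ∑ (suc r) (map (inside Vec.∷_) (subsets n)) ⟧ (a +θ b)
    ≡⟨ cong₂ _⊕_ (∑-outside (suc r) (subsets n) a b) (∑-inside-suc r (subsets n) a b) ⟩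
  (⟦ F (suc r) ⟧ a ⊕ 0Λ) +θ (signed (suc r) (⟦ F (suc r) ⟧ b) ⊕ ⟦ F r ⟧ a)
    ≡⟨ cong₂ _+θ_ (⊕-identityʳ _) (⊕-comm _ _) ⟩
  ⟦ F (suc r) ⟧ a +θ (⟦ F r ⟧ a ⊕ signed (suc r) (⟦ F (suc r) ⟧ b))
    ≡⟨ cong₂ _+θ_ (⟦F⟧ (suc r) a) (cong₂ _⊕_ (⟦F⟧ r a) (cong (signed (suc r)) (⟦F⟧ (suc r) b))) ⟩
  F* (suc r) (a +θ b) ∎
  where open ≡-Reasoning

-- Odd operators and the ideal in coefficients

-- The sign is that of an odd operator passing an element of degree `suc r`. Multiplication by a
-- variable and `contract` share this property, and it makes both preserve the ideal.
record Odd (T : Λ m → Λ n) : Set where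
  field
    linear  : Linear T
    F*-comm : ∀ r w → T (F* (suc r) w) ≡ signed (suc r) (F* (suc r) (T w))

  F*-comm′ : ∀ r w → T (F* r w) ≡ signed r (F* r (T w))
  F*-comm′ zero    w = ≡.refl
  F*-comm′ (suc r) w = F*-comm r w

open Odd

up-odd : {T : Λ m → Λ n} → Odd T → Odd (up T)
up-odd {T = T} O = record { linear = up-linear (linear O) ; F*-comm = comm }
  where
  open ≡-Reasoning
  comm : ∀ r w → up T (F* (suc r) w) ≡ signed (suc r) (F* (suc r) (up T w))
  comm r (a +θ b) = begin
    T (f a) +θ ⊖ T (F* r a ⊕ s (f b))
      ≡⟨ cong₂ _+θ_ (F*-comm O r a) (begin
        ⊖ T (F* r a ⊕ s (f b))
          ≡⟨ cong ⊖_ (⊕-homo (linear O) _ _) ⟩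
        ⊖ (T (F* r a) ⊕ T (s (f b)))
          ≡⟨ cong ⊖_ (cong₂ _⊕_ (F*-comm′ O r a) (signed-homo (linear O) (suc r) _)) ⟩
        ⊖ (signed r (F* r (T a)) ⊕ s (T (f b)))
          ≡⟨ ⊖-⊕-comm _ _ ⟨
        s (F* r (T a)) ⊕ ⊖ s (T (f b))
          ≡⟨ cong (λ x → _ ⊕ ⊖ s x) (F*-comm O r b) ⟩
        s (F* r (T a)) ⊕ ⊖ s (s (f (T b)))
          ≡⟨ cong (_ ⊕_)
               (⊖-homo (∘-linear s-linear (∘-linear s-linear (F*-linear (suc r)))) (T b)) ⟨
        s (F* r (T a)) ⊕ s (s (f (⊖ T b)))
          ≡⟨ ⊕-homo s-linear _ _ ⟨
        s (F* r (T a) ⊕ s (f (⊖ T b))) ∎) ⟩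
    s (f (T a)) +θ s (F* r (T a) ⊕ s (f (⊖ T b)))
      ≡⟨ signed-+θ (suc r) _ _ ⟨
    s (f (T a +θ ⊖ T b)) ∎
    where
    s f : ∀ {k} → Λ k → Λ k
    s = signed (suc r)
    f = F* (suc r)
    s-linear : ∀ {k} → Linear (s {k})
    s-linear = signed-linear (suc r)

θ₁*-odd : Odd (θ₁* {n})
θ₁*-odd = record { linear = θ₁*-linear ; F*-comm = comm }
  where
  open ≡-Reasoning
  comm : ∀ r w → θ₁* (F* (suc r) w) ≡ signed (suc r) (F* (suc r) (θ₁* w))
  comm r (a +θ b) = begin
      0Λ +θ f a
        ≡⟨ cong₂ _+θ_ (0-homo (∘-linear (signed-linear (suc r)) (F*-linear (suc r))))
                      (signed-involutive (suc r) _) ⟨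
      s (f 0Λ) +θ s (s (f a))
        ≡⟨ cong (λ x → s (f 0Λ) +θ s x) (⊕-identityˡ _) ⟨
      s (f 0Λ) +θ s (0Λ ⊕ s (f a))
        ≡⟨ cong (λ x → s (f 0Λ) +θ s (x ⊕ s (f a))) (0-homo (F*-linear r)) ⟨
      s (f 0Λ) +θ s (F* r 0Λ ⊕ s (f a))
        ≡⟨ signed-+θ (suc r) _ _ ⟨
      s (f (0Λ +θ a)) ∎
    where
    s f : ∀ {k} → Λ k → Λ k
    s = signed (suc r)
    f = F* (suc r)

θ*-odd : (i : Fin n) → Odd (θ* i)
θ*-odd zero    = θ₁*-odd
θ*-odd (suc i) = up-odd (θ*-odd i)

contract : Λ (suc (suc n)) → Λ n
contract ((a +θ b) +θ (c +θ d)) = b ⊕ ⊖ c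

-- The case split on `r` lets `F* r (a +θ b)` reduce; for positive `r` the sign must moreover be
-- moved inside `_+θ_`.
contract-F* : ∀ r (a b c d : Λ n) →
  contract (F* (suc r) ((a +θ b) +θ (c +θ d))) ≡
  (F* r a ⊕ signed (suc r) (F* (suc r) b)) ⊕ ⊖ (F* r a ⊕ signed (suc r) (F* (suc r) c))
contract-F* zero    a b c d = ≡.refl
contract-F* (suc r) a b c d
  rewrite signed-+θ r (F* (suc (suc r)) c)
                      (F* (suc r) c ⊕ signed (suc (suc r)) (F* (suc (suc r)) d))
  = ≡.refl

-- `F (suc r)` is symmetric in the first two variables, so it contributes the same `F* r a` to both
-- of their coefficients, and this cancels in the difference.
contract-odd : Odd (contract {n})
contract-odd {n} = record
  { linear = record
    { ⊕-homo = λ { ((_ +θ b) +θ (c +θ _)) ((_ +θ b′) +θ (c′ +θ _)) → ≡.trans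
        (cong (_ ⊕_) (≡.sym (⊖-⊕-comm c c′))) (⊕-interchange _ _ _ _) }
    ; ∙-homo = λ { q ((_ +θ b) +θ (c +θ _)) → ≡.trans
        (cong (_ ⊕_) (⊖-∙-comm q c)) (≡.sym (∙-distribˡ q _ _)) }
    }
  ; F*-comm = comm
  }
  where
  open ≡-Reasoning
  comm : ∀ r w → contract (F* (suc r) w) ≡ signed (suc r) (F* (suc r) (contract {n} w))
  comm r ((a +θ b) +θ (c +θ d)) = begin
    contract (F* (suc r) ((a +θ b) +θ (c +θ d)))
      ≡⟨ contract-F* r a b c d ⟩
    (F* r a ⊕ sf b) ⊕ ⊖ (F* r a ⊕ sf c)
      ≡⟨ cong (F* r a ⊕ sf b ⊕_) (⊖-⊕-comm _ _) ⟨
    (F* r a ⊕ sf b) ⊕ (⊖ F* r a ⊕ ⊖ sf c)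
      ≡⟨ ⊕-interchange _ _ _ _ ⟩
    (F* r a ⊕ ⊖ F* r a) ⊕ (sf b ⊕ ⊖ sf c)
      ≡⟨ cong₂ _⊕_ (⊖-inverseʳ _) (cong (_ ⊕_) (≡.sym (⊖-homo sf-linear c))) ⟩
    0Λ ⊕ (sf b ⊕ sf (⊖ c))
      ≡⟨ ⊕-identityˡ _ ⟩
    sf b ⊕ sf (⊖ c)
      ≡⟨ ⊕-homo sf-linear b (⊖ c) ⟨
    sf (b ⊕ ⊖ c) ∎
    where
    sf : Λ n → Λ n
    sf = signed (suc r) ∘ F* (suc r)
    sf-linear : Linear sf
    sf-linear = ∘-linear (signed-linear (suc r)) (F*-linear (suc r))

-- In coefficients, the right ideal generated by the `F r` with r ≥ 1. Closure under left
-- multiplication is derived from oddness of the variables.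
data ImF : Λ n → Set where
  image   : ∀ r (w : Λ n) → ImF (F* (suc r) w)
  0-image : ImF {n} 0Λ
  ⊕-image : {x y : Λ n} → ImF x → ImF y → ImF (x ⊕ y)

ImF-∙ : ∀ q {x : Λ n} → ImF x → ImF (q ∙ x)
ImF-∙ q (image r w) = ≡.subst ImF (∙-homo (F*-linear (suc r)) q w) (image r (q ∙ w))
ImF-∙ q 0-image        = ≡.subst ImF (≡.sym (0-homo (∙-linear q))) 0-image
ImF-∙ q (⊕-image x y)  = ≡.subst ImF (≡.sym (∙-distribˡ q _ _)) (⊕-image (ImF-∙ q x) (ImF-∙ q y))

ImF-⊖ : {x : Λ n} → ImF x → ImF (⊖ x)
ImF-⊖ (image r w) = ≡.subst ImF (⊖-homo (F*-linear (suc r)) w) (image r (⊖ w))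
ImF-⊖ 0-image        = ≡.subst ImF (≡.sym ⊖0≡0) 0-image
ImF-⊖ (⊕-image x y)  = ≡.subst ImF (⊖-⊕-comm _ _) (⊕-image (ImF-⊖ x) (ImF-⊖ y))

-- The sign from `F*-comm` is absorbed into the argument of `F*`.
ImF-odd : {T : Λ m → Λ n} → Odd T → ∀ {x} → ImF x → ImF (T x)
ImF-odd {T = T} O (image r w) = ≡.subst ImF
  (≡.trans (signed-homo (F*-linear (suc r)) (suc r) (T w)) (≡.sym (F*-comm O r w)))
  (image r (signed (suc r) (T w)))
ImF-odd O 0-image       = ≡.subst ImF (≡.sym (0-homo (linear O))) 0-image
ImF-odd O (⊕-image x y) = ≡.subst ImF
  (≡.sym (⊕-homo (linear O) _ _))
  (⊕-image (ImF-odd O x) (ImF-odd O y))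

ImF-⟦⟧ : ∀ (x : Expr n) {w} → ImF w → ImF (⟦ x ⟧ w)
ImF-⟦⟧ (con q) p = ImF-∙ q p
ImF-⟦⟧ (θ i)   p = ImF-odd (θ*-odd i) p
ImF-⟦⟧ (x + y) p = ⊕-image (ImF-⟦⟧ x p) (ImF-⟦⟧ y p)
ImF-⟦⟧ (x * y) p = ImF-⟦⟧ x (ImF-⟦⟧ y p)
ImF-⟦⟧ (- x)   p = ImF-⊖ (ImF-⟦⟧ x p)

-- Quantifying over `w` settles right multiplication: `x * a` acts on `w` as `x` does on `⟦ a ⟧ w`.
I⇒ImF : {x : Expr n} → I n x → ∀ w → ImF (⟦ x ⟧ w)
I⇒ImF (generator (suc r , _ , _ , ≡.refl)) w = ≡.subst ImF (≡.sym (⟦F⟧ (suc r) w)) (image r w)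
I⇒ImF 0-closed          w = ≡.subst ImF (≡.sym (∙-zeroˡ w)) 0-image
I⇒ImF (+-closed p q)    w = ⊕-image (I⇒ImF p w) (I⇒ImF q w)
I⇒ImF (*-closedˡ a p)   w = ImF-⟦⟧ a (I⇒ImF p w)
I⇒ImF (*-closedʳ a p)   w = I⇒ImF p (⟦ a ⟧ w)
I⇒ImF (≈-closed x≈y p)  w = ≡.subst ImF (⟦⟧-cong x≈y w) (I⇒ImF p w)

-- Leading terms of the ideal

coeff : Vec Bit n → Λ n → ℚ
coeff []       (scalar q) = q
coeff (0F ∷ α) (a +θ b)   = coeff α a
coeff (1F ∷ α) (a +θ b)   = coeff α b

coeff-⊕ : ∀ (α : Vec Bit n) x y → coeff α (x ⊕ y) ≡ coeff α x ℚ.+ coeff α y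
coeff-⊕ []       (scalar _) (scalar _) = ≡.refl
coeff-⊕ (0F ∷ α) (a +θ _) (c +θ _) = coeff-⊕ α a c
coeff-⊕ (1F ∷ α) (_ +θ b) (_ +θ d) = coeff-⊕ α b d

coeff-∙ : ∀ (α : Vec Bit n) q x → coeff α (q ∙ x) ≡ q ℚ.* coeff α x
coeff-∙ []       q (scalar _) = ≡.refl
coeff-∙ (0F ∷ α) q (a +θ _) = coeff-∙ α q a
coeff-∙ (1F ∷ α) q (_ +θ b) = coeff-∙ α q b

coeff-0 : (α : Vec Bit n) → coeff α 0Λ ≡ 0ℚ
coeff-0 []       = ≡.refl
coeff-0 (0F ∷ α) = coeff-0 α
coeff-0 (1F ∷ α) = coeff-0 α

-- The support of y contains no string that is lexicographically larger than α.
Bounded : Vec Bit n → Λ n → Set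
Bounded []       y        = ⊤
Bounded (0F ∷ α) (a +θ b) = Bounded α a × b ≡ 0Λ
Bounded (1F ∷ α) (a +θ b) = Bounded α b

Bounded-⊕ : ∀ (α : Vec Bit n) {x y} → Bounded α x → Bounded α y → Bounded α (x ⊕ y)
Bounded-⊕ []       {scalar _} {scalar _} _ _ = tt
Bounded-⊕ (0F ∷ α) {_ +θ _} {_ +θ _} (p , ≡.refl) (q , ≡.refl) = Bounded-⊕ α p q , ⊕-identityˡ 0Λ
Bounded-⊕ (1F ∷ α) {_ +θ _} {_ +θ _} p q = Bounded-⊕ α p q

Bounded-∙ : ∀ (α : Vec Bit n) q {x} → Bounded α x → Bounded α (q ∙ x)
Bounded-∙ []       q {scalar _} _ = tt
Bounded-∙ (0F ∷ α) q {_ +θ _} (p , ≡.refl) = Bounded-∙ α q p , 0-homo (∙-linear q)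
Bounded-∙ (1F ∷ α) q {_ +θ _} p = Bounded-∙ α q p

-- The coefficient at `α` may be zero; if it is not, the leading term at `α` becomes one at `β`.
Transfers : (Λ m → Λ n) → Vec Bit m → Vec Bit n → Set
Transfers T α β = ∀ y → Bounded α y → Bounded β (T y) × coeff β (T y) ≡ coeff α y

up-transfers : ∀ {T : Λ m → Λ n} (α : Vec Bit m) (β : Vec Bit n) →
               Linear T → Transfers T α β → Transfers (up T) (0F ∷ α) (0F ∷ β)
up-transfers α β L t (a +θ _) (p , ≡.refl) =
  (proj₁ (t a p) , ≡.trans (cong ⊖_ (0-homo L)) ⊖0≡0) , proj₂ (t a p)

-- Strings that begin with 1 exceed 01α, so the θ₁-part vanishes and `contract` returns `b`, the
-- coefficient of θ₂.
contract-transfers : (α : Vec Bit n) → Transfers contract (0F ∷ 1F ∷ α) α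
contract-transfers α ((a +θ b) +θ (_ +θ _)) (p , ≡.refl) = ≡.subst
  (λ x → Bounded α x × coeff α x ≡ coeff α b)
  (≡.sym (≡.trans (cong (b ⊕_) ⊖0≡0) (⊕-identityʳ b)))
  (p , ≡.refl)

infixr 6 _⊹_

-- Addition by iterated shifting, so that prepending zeros needs no index coercion.
_⊹_ : ℕ → ℕ → ℕ
zero  ⊹ m = m
suc i ⊹ m = i ⊹ suc m

pad : ∀ i → Vec Bit m → Vec Bit (i ⊹ m)
pad zero    v = v
pad (suc i) v = pad i (0F ∷ v)

ups : ∀ i → (Λ m → Λ n) → Λ (i ⊹ m) → Λ (i ⊹ n)
ups zero    T = T
ups (suc i) T = ups i (up T)

ups-odd : ∀ i {T : Λ m → Λ n} → Odd T → Odd (ups i T)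
ups-odd zero    O = O
ups-odd (suc i) O = ups-odd i (up-odd O)

ups-transfers : ∀ i {T : Λ m → Λ n} (α : Vec Bit m) (β : Vec Bit n) →
                Linear T → Transfers T α β → Transfers (ups i T) (pad i α) (pad i β)
ups-transfers zero    α β L t = t
ups-transfers (suc i) α β L t =
  ups-transfers i (0F ∷ α) (0F ∷ β) (up-linear L) (up-transfers α β L t)

NoLeading : Vec Bit n → Set
NoLeading α = ∀ {y} → ImF y → Bounded α y → coeff α y ≡ 0ℚ

-- `pad i []` consists of zeros, so this is the constant term. The inner `go` generalises the string
-- because `pad` accumulates.
coeff-pad-[]-F* : ∀ i r w → coeff (pad i []) (F* (suc r) w) ≡ 0ℚ
coeff-pad-[]-F* i r = go i (λ { (scalar _) → ≡.refl })
  where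
  go : ∀ i {α : Vec Bit m} → (∀ w → coeff α (F* (suc r) w) ≡ 0ℚ) →
       ∀ w → coeff (pad i α) (F* (suc r) w) ≡ 0ℚ
  go zero    p = p
  go (suc i) p = go i (λ { (a +θ _) → p a })

pad-[]-noLeading : ∀ i → NoLeading (pad i [])
pad-[]-noLeading i p _ = go p
  where
  go : ∀ {y} → ImF y → coeff (pad i []) y ≡ 0ℚ
  go (image r w)   = coeff-pad-[]-F* i r w
  go 0-image       = coeff-0 (pad i [])
  go (⊕-image p q) = ≡.trans (coeff-⊕ (pad i []) _ _) (cong₂ ℚ._+_ (go p) (go q))

transfer-noLeading : ∀ {T : Λ m → Λ n} (α : Vec Bit m) (β : Vec Bit n) →
                     Odd T → Transfers T α β → NoLeading β → NoLeading α
transfer-noLeading α β O t noLeading {y} p bounded =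
  let (bounded′ , eq) = t y bounded in ≡.trans (≡.sym eq) (noLeading (ImF-odd O p) bounded′)

-- The part of the word already read is 0ⁱ: a letter 1 is deleted together
-- with the last of these zeros, by contract.
breaks-or-noLeading′ : ∀ i (v : Vec Bit m) →
  (∃[ r ] r ≤ m × i ℕ.+ r < 2 ℕ.* ones (take r (toList v))) ⊎ NoLeading (pad i v)
breaks-or-noLeading′ i [] = inj₂ (pad-[]-noLeading i)
breaks-or-noLeading′ i (0F ∷ v) with breaks-or-noLeading′ (suc i) v
... | inj₁ (r , r≤m , lt) = inj₁ (suc r , s≤s r≤m ,
  ≡.subst (_< 2 ℕ.* ones (take r (toList v))) (≡.sym (ℕₚ.+-suc i r)) lt)
... | inj₂ noLeading      = inj₂ noLeading
-- No zero is left to pair with this 1, so the ballot condition breaks right here.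
breaks-or-noLeading′ zero (1F ∷ v) = inj₁ (1 , s≤s z≤n , s≤s (s≤s z≤n))
breaks-or-noLeading′ (suc i) (1F ∷ v) with breaks-or-noLeading′ i v
... | inj₁ (r , r≤m , lt) = inj₁ (suc r , s≤s r≤m , (begin-strict
  -- Restoring the deleted pair 01 adds two letters on the left and twice a single 1 on the right.
  suc i ℕ.+ suc r       ≡⟨ ℕₚ.+-suc (suc i) r ⟩
  2 ℕ.+ (i ℕ.+ r)       <⟨ ℕₚ.+-monoʳ-< 2 lt ⟩
  2 ℕ.+ 2 ℕ.* k         ≡⟨ ℕₚ.*-distribˡ-+ 2 1 k ⟨
  2 ℕ.* suc k           ∎))
  where
  open ℕₚ.≤-Reasoning
  k = ones (take r (toList v))
-- By definition `pad (suc i) (1F ∷ v)` is `pad i (0F ∷ 1F ∷ v)`: the last zero stands next to the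
-- 1, behind `i` zeros over which `ups` lifts `contract`.
... | inj₂ noLeading = inj₂ (transfer-noLeading (pad i (0F ∷ 1F ∷ v)) (pad i v)
  (ups-odd i contract-odd)
  (ups-transfers i (0F ∷ 1F ∷ v) v (linear contract-odd) (contract-transfers v)) noLeading)

breaks-or-noLeading : (α : Vec Bit n) → BreaksBallot α ⊎ NoLeading α
breaks-or-noLeading α with breaks-or-noLeading′ 0 α
-- Position 0 cannot occur, as it would require 0 < 0.
... | inj₁ (suc r , r≤n , lt) = inj₁ (suc r , s≤s z≤n , r≤n , lt)
... | inj₂ noLeading          = inj₂ noLeading

-- Leading terms of G

module _ {n : ℕ} where
  open Ring (R n) using (1#; semiring)
  open Exp semiring using (_^_)

  ⟦⟧-sign : ∀ k w → ⟦ (- 1#) ^ k ⟧ w ≡ signed k w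
  ⟦⟧-sign zero    w = ∙-identityˡ w
  ⟦⟧-sign (suc k) w = cong ⊖_ (≡.trans (∙-identityˡ _) (⟦⟧-sign k w))

letters : List (Fin n × Bit) → List Bit
letters = map proj₂

-- G-aux over Λ with F replaced by f and m ones in front of the letters of v.
G* : ℕ → (ℕ → Λ n) → List (Fin n × Bit) → ℕ → Λ n
G* m f []             s       = f s
G* m f ((k , 1F) ∷ v) s       = G* m f v (suc s)
G* m f ((k , 0F) ∷ v) zero    = G* m f v zero
G* m f ((k , 0F) ∷ v) (suc s) =
  G* m f v (suc s) ⊕ ⊖ signed (m ℕ.+ ones (letters v)) (θ* k (G* m f v s))

⟦G-aux⟧ : ∀ (v : List (Fin n × Bit)) s w → ⟦ G-aux v s ⟧ w ≡ G* 0 (λ s → F* s w) v s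
⟦G-aux⟧ []             s       w = ⟦F⟧ s w
⟦G-aux⟧ ((k , 1F) ∷ v) s       w = ⟦G-aux⟧ v (suc s) w
⟦G-aux⟧ ((k , 0F) ∷ v) zero    w = ⟦G-aux⟧ v zero w
⟦G-aux⟧ ((k , 0F) ∷ v) (suc s) w = cong₂ (λ x y → x ⊕ ⊖ y) (⟦G-aux⟧ v (suc s) w)
  (≡.trans (⟦⟧-sign (ones (letters v)) _) (cong (signed (ones (letters v)) ∘ θ* k) (⟦G-aux⟧ v s w)))

G*-cong : ∀ m {f g : ℕ → Λ n} → (∀ s → f s ≡ g s) → ∀ v s → G* m f v s ≡ G* m g v s
G*-cong m f≡g []             s       = f≡g s
G*-cong m f≡g ((k , 1F) ∷ v) s       = G*-cong m f≡g v (suc s)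
G*-cong m f≡g ((k , 0F) ∷ v) zero    = G*-cong m f≡g v zero
G*-cong m f≡g ((k , 0F) ∷ v) (suc s) =
  cong₂ (λ x y → x ⊕ ⊖ signed (m ℕ.+ ones (letters v)) (θ* k y))
    (G*-cong m f≡g v (suc s)) (G*-cong m f≡g v s)

G*-0 : ∀ m (v : List (Fin n × Bit)) s → G* m (λ _ → 0Λ) v s ≡ 0Λ
G*-0 m []             s       = ≡.refl
G*-0 m ((k , 1F) ∷ v) s       = G*-0 m v (suc s)
G*-0 m ((k , 0F) ∷ v) zero    = G*-0 m v zero
G*-0 m ((k , 0F) ∷ v) (suc s) = begin
  G* m _ v (suc s) ⊕ ⊖ signed j (θ* k (G* m _ v s))
    ≡⟨ cong₂ (λ x y → x ⊕ ⊖ signed j (θ* k y)) (G*-0 m v (suc s)) (G*-0 m v s) ⟩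
  0Λ ⊕ ⊖ signed j (θ* k 0Λ)
    ≡⟨ ⊕-identityˡ _ ⟩
  signed (suc j) (θ* k 0Λ)
    ≡⟨ 0-homo (∘-linear (signed-linear (suc j)) (θ*-linear k)) ⟩
  0Λ ∎
  where
  open ≡-Reasoning
  j = m ℕ.+ ones (letters v)

-- Only the parity of the number of ones enters the signs.
G*-sign : ∀ m (f : ℕ → Λ n) v s → G* (2 ℕ.+ m) f v s ≡ G* m f v s
G*-sign m f []             s       = ≡.refl
G*-sign m f ((k , 1F) ∷ v) s       = G*-sign m f v (suc s)
G*-sign m f ((k , 0F) ∷ v) zero    = G*-sign m f v zero
G*-sign m f ((k , 0F) ∷ v) (suc s) = cong₂ (λ x y → x ⊕ ⊖ y) (G*-sign m f v (suc s))
  (≡.trans (⊖-involutive _) (cong (signed (m ℕ.+ ones (letters v)) ∘ θ* k) (G*-sign m f v s)))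

shift : List (Fin n × Bit) → List (Fin (suc n) × Bit)
shift = map (Product.map₁ suc)

letters-shift : (v : List (Fin n × Bit)) → letters (shift v) ≡ letters v
letters-shift v = ≡.sym (Listₚ.map-∘ v)

-- In the θ₁-part every later variable must pass θ₁; the extra sign has the same effect as one more
-- 1 in front, whence `suc m`.
G*-shift : ∀ m (f g : ℕ → Λ n) v s →
           G* m (λ s → f s +θ g s) (shift v) s ≡ G* m f v s +θ G* (suc m) g v s
G*-shift m f g []             s       = ≡.refl
G*-shift m f g ((k , 1F) ∷ v) s       = G*-shift m f g v (suc s)
G*-shift m f g ((k , 0F) ∷ v) zero    = G*-shift m f g v zero
G*-shift m f g ((k , 0F) ∷ v) (suc s) = begin
  x ⊕ ⊖ signed (m ℕ.+ ones (letters (shift v))) (θ* (suc k) y)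
    ≡⟨ cong (λ u → x ⊕ ⊖ signed (m ℕ.+ ones u) (θ* (suc k) y)) (letters-shift v) ⟩
  x ⊕ ⊖ signed j (θ* (suc k) y)
    ≡⟨ cong₂ (λ x y → x ⊕ ⊖ signed j (θ* (suc k) y))
         (G*-shift m f g v (suc s)) (G*-shift m f g v s) ⟩
  (a +θ b) ⊕ ⊖ signed j (θ* k c +θ ⊖ θ* k d)
    ≡⟨ cong (λ x → (a +θ b) ⊕ ⊖ x) (signed-+θ j _ _) ⟩
  (a ⊕ ⊖ signed j (θ* k c)) +θ (b ⊕ ⊖ signed j (⊖ θ* k d))
    ≡⟨ cong (λ x → (a ⊕ ⊖ signed j (θ* k c)) +θ (b ⊕ ⊖ x)) (⊖-homo (signed-linear j) _) ⟩
  (a ⊕ ⊖ signed j (θ* k c)) +θ (b ⊕ ⊖ signed (suc j) (θ* k d)) ∎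
  where
  open ≡-Reasoning
  j = m ℕ.+ ones (letters v)
  a = G* m f v (suc s)
  b = G* (suc m) g v (suc s)
  c = G* m f v s
  d = G* (suc m) g v s
  x = G* m (λ s → f s +θ g s) (shift v) (suc s)
  y = G* m (λ s → f s +θ g s) (shift v) s

-- The recursion step at the first letter of the word, applied to the base values `f`. No letters
-- precede it, so there is no sign.
first : Bit → (ℕ → Λ (suc n)) → ℕ → Λ (suc n)
first 1F f s       = f (suc s)
first 0F f zero    = f zero
first 0F f (suc s) = f (suc s) ⊕ ⊖ θ* zero (f s)

ones-∷ʳ : ∀ u b → ones (u ++ b ∷ []) ≡ toℕ b ℕ.+ ones u
ones-∷ʳ u b = sum-↭ (Permₚ.map⁺ toℕ (Permₚ.++-comm u (b ∷ [])))

-- The first letter of the word is read last: it modifies the base values, and at all other letters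
-- it only adds `toℕ b` to the exponent of the sign.
G*-∷ʳ : ∀ b f (v : List (Fin (suc n) × Bit)) s →
        G* 0 f (v ++ (zero , b) ∷ []) s ≡ G* (toℕ b) (first b f) v s
G*-∷ʳ 0F f []             zero    = ≡.refl
G*-∷ʳ 0F f []             (suc s) = ≡.refl
G*-∷ʳ 1F f []             s       = ≡.refl
G*-∷ʳ b  f ((k , 1F) ∷ v) s       = G*-∷ʳ b f v (suc s)
G*-∷ʳ b  f ((k , 0F) ∷ v) zero    = G*-∷ʳ b f v zero
G*-∷ʳ b  f ((k , 0F) ∷ v) (suc s) = begin
  G* 0 f v′ (suc s) ⊕ ⊖ signed (ones (letters v′)) (θ* k (G* 0 f v′ s))
    ≡⟨ cong (λ j → G* 0 f v′ (suc s) ⊕ ⊖ signed j (θ* k (G* 0 f v′ s)))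
         (≡.trans (cong ones (Listₚ.map-++ proj₂ v _)) (ones-∷ʳ (letters v) b)) ⟩
  G* 0 f v′ (suc s) ⊕ ⊖ signed (toℕ b ℕ.+ ones (letters v)) (θ* k (G* 0 f v′ s))
    ≡⟨ cong₂ (λ x y → x ⊕ ⊖ signed (toℕ b ℕ.+ ones (letters v)) (θ* k y))
         (G*-∷ʳ b f v (suc s)) (G*-∷ʳ b f v s) ⟩
  _ ∎
  where
  open ≡-Reasoning
  v′ = v ++ (zero , b) ∷ []

F*-1-suc : ∀ s → F* {suc n} (suc s) 1Λ ≡ F* (suc s) 1Λ +θ F* s 1Λ
F*-1-suc s = cong (F* (suc s) 1Λ +θ_) (≡.trans
  (cong (F* s 1Λ ⊕_) (0-homo (∘-linear (signed-linear (suc s)) (F*-linear (suc s)))))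
  (⊕-identityʳ _))

positions : Vec Bit n → List (Fin n × Bit)
positions α = reverse (toList (Vec.zip (Vec.allFin _) α))

positions-∷ : ∀ b (α : Vec Bit n) → positions (b ∷ α) ≡ shift (positions α) ++ (zero , b) ∷ []
positions-∷ b α = begin
  reverse ((zero , b) ∷ toList (Vec.zip (Vec.tabulate suc) α))
    ≡⟨ Listₚ.unfold-reverse _ (toList (Vec.zip (Vec.tabulate suc) α)) ⟩
  reverse (toList (Vec.zip (Vec.tabulate suc) α)) ++ (zero , b) ∷ []
    ≡⟨ cong (λ v → reverse v ++ (zero , b) ∷ []) toList-zip-suc ⟩
  reverse (shift (toList (Vec.zip (Vec.allFin _) α))) ++ (zero , b) ∷ []
    ≡⟨ cong (_++ (zero , b) ∷ []) (Listₚ.reverse-map _ (toList (Vec.zip (Vec.allFin _) α))) ⟨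
  shift (positions α) ++ (zero , b) ∷ [] ∎
  where
  open ≡-Reasoning
  toList-zip-suc : toList (Vec.zip (Vec.tabulate suc) α) ≡ shift (toList (Vec.zip (Vec.allFin _) α))
  toList-zip-suc = begin
    toList (Vec.zip (Vec.tabulate suc) α)
      ≡⟨ cong₂ (λ is β → toList (Vec.zip is β)) (Vecₚ.tabulate-∘ suc id) (≡.sym (Vecₚ.map-id α)) ⟩
    toList (Vec.zip (Vec.map suc (Vec.allFin _)) (Vec.map id α))
      ≡⟨ cong toList (Vecₚ.map-zip suc id (Vec.allFin _) α) ⟨
    toList (Vec.map (Product.map₁ suc) (Vec.zip (Vec.allFin _) α))
      ≡⟨ Vecₚ.toList-map _ (Vec.zip (Vec.allFin _) α) ⟩
    shift (toList (Vec.zip (Vec.allFin _) α)) ∎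

⟦G⟧ : Vec Bit n → Λ n
⟦G⟧ α = ⟦ G α ⟧ 1Λ

⟦G⟧-first : ∀ b (α : Vec Bit n) →
            ⟦G⟧ (b ∷ α) ≡ G* (toℕ b) (first b (λ s → F* s 1Λ)) (shift (positions α)) 0
⟦G⟧-first b α = begin
  ⟦ G-aux (positions (b ∷ α)) 0 ⟧ 1Λ
    ≡⟨ ⟦G-aux⟧ (positions (b ∷ α)) 0 1Λ ⟩
  G* 0 (λ s → F* s 1Λ) (positions (b ∷ α)) 0
    ≡⟨ cong (λ v → G* 0 (λ s → F* s 1Λ) v 0) (positions-∷ b α) ⟩
  G* 0 (λ s → F* s 1Λ) (shift (positions α) ++ (zero , b) ∷ []) 0
    ≡⟨ G*-∷ʳ b _ (shift (positions α)) 0 ⟩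
  G* (toℕ b) (first b (λ s → F* s 1Λ)) (shift (positions α)) 0 ∎
  where open ≡-Reasoning

-- The leading 0 replaces each base value Fₛ by Fₛ - θ₁ Fₛ₋₁ (for s ≥ 1), which removes exactly the
-- terms with θ₁ and leaves Fₛ in the remaining variables.
⟦G⟧-0∷ : (α : Vec Bit n) → ⟦G⟧ (0F ∷ α) ≡ ⟦G⟧ α +θ 0Λ
⟦G⟧-0∷ α = begin
  ⟦G⟧ (0F ∷ α)
    ≡⟨ ⟦G⟧-first 0F α ⟩
  G* 0 (first 0F (λ s → F* s 1Λ)) (shift (positions α)) 0
    ≡⟨ G*-cong 0 first-F* (shift (positions α)) 0 ⟩
  G* 0 (λ s → F* s 1Λ +θ 0Λ) (shift (positions α)) 0
    ≡⟨ G*-shift 0 _ _ (positions α) 0 ⟩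
  G* 0 (λ s → F* s 1Λ) (positions α) 0 +θ G* 1 (λ _ → 0Λ) (positions α) 0
    ≡⟨ cong₂ _+θ_ (≡.sym (⟦G-aux⟧ (positions α) 0 1Λ)) (G*-0 1 (positions α) 0) ⟩
  ⟦G⟧ α +θ 0Λ ∎
  where
  open ≡-Reasoning
  θ₁*-F* : ∀ s → θ₁* {n} (F* s 1Λ) ≡ 0Λ +θ F* s 1Λ
  θ₁*-F* zero    = ≡.refl
  θ₁*-F* (suc s) = ≡.refl
  first-F* : ∀ s → first {n} 0F (λ s → F* s 1Λ) s ≡ F* s 1Λ +θ 0Λ
  first-F* zero    = ≡.refl
  first-F* (suc s) = begin
    F* (suc s) 1Λ ⊕ ⊖ θ₁* (F* s 1Λ)
      ≡⟨ cong₂ (λ x y → x ⊕ ⊖ y) (F*-1-suc s) (θ₁*-F* s) ⟩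
    (F* (suc s) 1Λ ⊕ ⊖ 0Λ) +θ (F* s 1Λ ⊕ ⊖ F* s 1Λ)
      ≡⟨ cong₂ _+θ_ (≡.trans (cong (F* (suc s) 1Λ ⊕_) ⊖0≡0) (⊕-identityʳ _)) (⊖-inverseʳ _) ⟩
    F* (suc s) 1Λ +θ 0Λ ∎

-- The leading 1 replaces Fₛ by Fₛ₊₁, whose θ₁-part is Fₛ in the remaining variables. Two extra
-- signs arise, from the letter 1 and from passing θ₁, and they cancel.
⟦G⟧-1∷ : (α : Vec Bit n) → ∃[ x ] ⟦G⟧ (1F ∷ α) ≡ x +θ ⟦G⟧ α
⟦G⟧-1∷ α = _ , (begin
  ⟦G⟧ (1F ∷ α)
    ≡⟨ ⟦G⟧-first 1F α ⟩
  G* 1 (first 1F (λ s → F* s 1Λ)) (shift (positions α)) 0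
    ≡⟨ G*-cong 1 F*-1-suc (shift (positions α)) 0 ⟩
  G* 1 (λ s → F* (suc s) 1Λ +θ F* s 1Λ) (shift (positions α)) 0
    ≡⟨ G*-shift 1 _ _ (positions α) 0 ⟩
  G* 1 (λ s → F* (suc s) 1Λ) (positions α) 0 +θ G* 2 (λ s → F* s 1Λ) (positions α) 0
    ≡⟨ cong (G* 1 _ (positions α) 0 +θ_)
         (≡.trans (G*-sign 0 _ (positions α) 0) (≡.sym (⟦G-aux⟧ (positions α) 0 1Λ))) ⟩
  G* 1 (λ s → F* (suc s) 1Λ) (positions α) 0 +θ ⟦G⟧ α ∎)
  where open ≡-Reasoning

⟦G⟧-bounded : (α : Vec Bit n) → Bounded α (⟦G⟧ α)
⟦G⟧-bounded []       = tt
⟦G⟧-bounded (0F ∷ α) rewrite ⟦G⟧-0∷ α = ⟦G⟧-bounded α , ≡.refl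
⟦G⟧-bounded (1F ∷ α) rewrite proj₂ (⟦G⟧-1∷ α) = ⟦G⟧-bounded α

⟦G⟧-leading : (α : Vec Bit n) → coeff α (⟦G⟧ α) ≡ 1ℚ
⟦G⟧-leading []       = ≡.refl
⟦G⟧-leading (0F ∷ α) rewrite ⟦G⟧-0∷ α = ⟦G⟧-leading α
⟦G⟧-leading (1F ∷ α) rewrite proj₂ (⟦G⟧-1∷ α) = ⟦G⟧-leading α

-- Membership of G in the ideal

2*suc : ∀ k s → 2 ℕ.* suc k ℕ.+ s ≡ suc (2 ℕ.* k ℕ.+ suc s)
2*suc k s = begin
  2 ℕ.* suc k ℕ.+ s          ≡⟨ cong (ℕ._+ s) (ℕₚ.*-suc 2 k) ⟩
  suc (suc (2 ℕ.* k ℕ.+ s))  ≡⟨ cong suc (ℕₚ.+-suc (2 ℕ.* k) s) ⟨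
  suc (2 ℕ.* k ℕ.+ suc s)    ∎
  where open ≡-Reasoning

module _ {n : ℕ} where
  open Ring (R n) using (1#; semiring)
  open RingProperties (R n) using (-‿distribˡ-*)
  open Exp semiring using (_^_)

  I-linear : ∀ {x y} c → I n x → I n y → I n (x + - (c * y))
  I-linear c p q = +-closed p (≈-closed (sym (-‿distribˡ-* c _)) (*-closedˡ (- c) q))

  -- Both inequalities are invariants of the recursion. A 1 trades an unread letter for an increase
  -- of `s`; a 0 shortens `v` and lowers `s` by at most one. At the end they read s ≤ n and 0 < s.
  G-aux∈I : ∀ (v : List (Fin n × Bit)) s → s ℕ.+ length v ≤ n →
            length v < 2 ℕ.* ones (letters v) ℕ.+ s → I n (G-aux v s)
  G-aux∈I [] s s≤n 0<s =
    generator (s , 0<s , ≡.subst (_≤ n) (ℕₚ.+-identityʳ s) s≤n , ≡.refl)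
  G-aux∈I ((k , 1F) ∷ v) s s≤n lt = G-aux∈I v (suc s)
    (≡.subst (_≤ n) (ℕₚ.+-suc s (length v)) s≤n)
    (s≤s⁻¹ (≡.subst (suc (length v) <_) (2*suc (ones (letters v)) s) lt))
  G-aux∈I ((k , 0F) ∷ v) zero s≤n lt = G-aux∈I v zero (ℕₚ.<⇒≤ s≤n) (ℕₚ.<-trans (ℕₚ.n<1+n _) lt)
  G-aux∈I ((k , 0F) ∷ v) (suc s) s≤n lt = I-linear ((- 1#) ^ ones (letters v) * θ k)
    (G-aux∈I v (suc s) s+v≤n (ℕₚ.<-trans (ℕₚ.n<1+n _) lt))
    (G-aux∈I v s (ℕₚ.<⇒≤ s+v≤n)
      (s≤s⁻¹ (≡.subst (suc (length v) <_) (ℕₚ.+-suc (2 ℕ.* ones (letters v)) s) lt)))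
    where
    s+v≤n : suc s ℕ.+ length v ≤ n
    s+v≤n = ℕₚ.≤-trans (ℕₚ.+-monoʳ-≤ (suc s) (ℕₚ.n≤1+n _)) s≤n

  -- Here `w` is the breaking prefix. The letters `v` after it are arbitrary: whichever `s` they
  -- hand over, it is nonnegative and can only help.
  G-aux-++∈I : ∀ (v w : List (Fin n × Bit)) s → s ℕ.+ length (v ++ w) ≤ n →
               length w < 2 ℕ.* ones (letters w) → I n (G-aux (v ++ w) s)
  G-aux-++∈I [] w s s≤n lt = G-aux∈I w s s≤n (ℕₚ.≤-trans lt (ℕₚ.m≤m+n _ s))
  G-aux-++∈I ((k , 1F) ∷ v) w s s≤n lt =
    G-aux-++∈I v w (suc s) (≡.subst (_≤ n) (ℕₚ.+-suc s (length (v ++ w))) s≤n) lt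
  G-aux-++∈I ((k , 0F) ∷ v) w zero s≤n lt = G-aux-++∈I v w zero (ℕₚ.<⇒≤ s≤n) lt
  G-aux-++∈I ((k , 0F) ∷ v) w (suc s) s≤n lt = I-linear ((- 1#) ^ ones (letters (v ++ w)) * θ k)
    (G-aux-++∈I v w (suc s) s+vw≤n lt)
    (G-aux-++∈I v w s (ℕₚ.<⇒≤ s+vw≤n) lt)
    where
    s+vw≤n : suc s ℕ.+ length (v ++ w) ≤ n
    s+vw≤n = ℕₚ.≤-trans (ℕₚ.+-monoʳ-≤ (suc s) (ℕₚ.n≤1+n _)) s≤n

ones-reverse : ∀ u → ones (reverse u) ≡ ones u
ones-reverse u = sum-↭ (Permₚ.map⁺ toℕ (Permₚ.↭-reverse u))

breaks⇒G∈I : (α : Vec Bit n) → BreaksBallot α → I n (G α)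
breaks⇒G∈I {n} α (r , _ , _ , r<2k) = ≡.subst (λ v → I n (G-aux v 0)) (≡.sym split)
  -- Letters are read from the last to the first, so the breaking prefix of length `r` comes second.
  (G-aux-++∈I (reverse (drop r z)) (reverse (take r z)) 0
    (ℕₚ.≤-reflexive (begin
      length (reverse (drop r z) ++ reverse (take r z))
        ≡⟨ cong length split ⟨
      length (reverse z)
        ≡⟨ Listₚ.length-reverse z ⟩
      length z
        ≡⟨ Vecₚ.length-toList (Vec.zip (Vec.allFin n) α) ⟩
      n ∎))
    (ℕₚ.≤-<-trans
      (≡.subst (_≤ r)
        (≡.sym (≡.trans (Listₚ.length-reverse (take r z)) (Listₚ.length-take r z)))
        (ℕₚ.m⊓n≤m r _))
      (≡.subst (λ k → r < 2 ℕ.* k) (≡.sym ones-take) r<2k)))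
  where
  open ≡-Reasoning
  z = toList (Vec.zip (Vec.allFin n) α)
  split : reverse z ≡ reverse (drop r z) ++ reverse (take r z)
  split = ≡.trans
    (cong reverse (≡.sym (Listₚ.take++drop≡id r z)))
    (Listₚ.reverse-++ (take r z) (drop r z))
  ones-take : ones (letters (reverse (take r z))) ≡ ones (take r (toList α))
  ones-take = begin
    ones (letters (reverse (take r z)))
      ≡⟨ cong ones (Listₚ.reverse-map proj₂ (take r z)) ⟩
    ones (reverse (letters (take r z)))
      ≡⟨ ones-reverse (letters (take r z)) ⟩
    ones (letters (take r z))
      ≡⟨ cong ones (Listₚ.take-map r z) ⟨
    ones (take r (letters z))
      ≡⟨ cong (ones ∘ take r) (Vecₚ.toList-map proj₂ (Vec.zip (Vec.allFin n) α)) ⟨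
    ones (take r (toList (Vec.map proj₂ (Vec.zip (Vec.allFin n) α))))
      ≡⟨ cong (ones ∘ take r ∘ toList) (Vecₚ.map-proj₂-zip (Vec.allFin n) α) ⟩
    ones (take r (toList α)) ∎

-- Linear combinations

module _ {A : Set} where

  comb : (A → Λ n) → (A → ℚ) → List A → Λ n
  comb g a = foldr (λ j x → a j ∙ g j ⊕ x) 0Λ

  comb-0 : ∀ (g : A → Λ n) {a} {js} → All (λ j → a j ≡ 0ℚ) js → comb g a js ≡ 0Λ
  comb-0 g []            = ≡.refl
  comb-0 g {a} {j ∷ js} (a≡0 ∷ as≡0) = begin
    a j ∙ g j ⊕ comb g a js  ≡⟨ cong₂ (λ q x → q ∙ g j ⊕ x) a≡0 (comb-0 g as≡0) ⟩
    0ℚ ∙ g j ⊕ 0Λ            ≡⟨ ⊕-identityʳ _ ⟩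
    0ℚ ∙ g j                 ≡⟨ ∙-zeroˡ (g j) ⟩
    0Λ                       ∎
    where open ≡-Reasoning

  module _ (_≟_ : DecidableEquality A) where

    _[_≔_] : (A → ℚ) → A → ℚ → A → ℚ
    (a [ j ≔ q ]) k = if does (j ≟ k) then q else a k

    update-≡ : ∀ a j q → (a [ j ≔ q ]) j ≡ q
    update-≡ a j q with j ≟ j
    ... | yes _   = ≡.refl
    ... | no  j≢j = contradiction ≡.refl j≢j

    update-≢ : ∀ a {j k} q → j ≢ k → (a [ j ≔ q ]) k ≡ a k
    update-≢ a {j} {k} q j≢k with j ≟ k
    ... | yes j≡k = contradiction j≡k j≢k
    ... | no  _   = ≡.refl

    comb-update-∉ : ∀ (g : A → Λ n) a {j} q {js} → All (j ≢_) js →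
                    comb g (a [ j ≔ q ]) js ≡ comb g a js
    comb-update-∉ g a q []          = ≡.refl
    comb-update-∉ g a q (j≢k ∷ j∉)  =
      cong₂ (λ p x → p ∙ g _ ⊕ x) (update-≢ a q j≢k) (comb-update-∉ g a q j∉)

    comb-update-∈ : ∀ (g : A → Λ n) a {j} q {js} → Unique js → j ∈ js →
                    comb g (a [ j ≔ q ℚ.+ a j ]) js ≡ q ∙ g j ⊕ comb g a js
    comb-update-∈ g a {j} q {j ∷ js} (j∉ ∷ _) (here ≡.refl) = begin
      (a [ j ≔ q ℚ.+ a j ]) j ∙ g j ⊕ comb g (a [ j ≔ q ℚ.+ a j ]) js
        ≡⟨ cong₂ (λ p x → p ∙ g j ⊕ x) (update-≡ a j (q ℚ.+ a j))
             (comb-update-∉ g a (q ℚ.+ a j) j∉) ⟩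
      (q ℚ.+ a j) ∙ g j ⊕ comb g a js
        ≡⟨ cong (_⊕ comb g a js) (∙-distribʳ q (a j) (g j)) ⟩
      (q ∙ g j ⊕ a j ∙ g j) ⊕ comb g a js
        ≡⟨ ⊕-assoc _ _ _ ⟩
      q ∙ g j ⊕ (a j ∙ g j ⊕ comb g a js) ∎
      where open ≡-Reasoning
    comb-update-∈ g a {j} q {k ∷ js} (k∉ ∷ unique) (there j∈js) = begin
      (a [ j ≔ q ℚ.+ a j ]) k ∙ g k ⊕ comb g (a [ j ≔ q ℚ.+ a j ]) js
        ≡⟨ cong₂ (λ p x → p ∙ g k ⊕ x) (update-≢ a (q ℚ.+ a j) (≡.≢-sym (All.lookup k∉ j∈js)))
             (comb-update-∈ g a q unique j∈js) ⟩
      a k ∙ g k ⊕ (q ∙ g j ⊕ comb g a js)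
        ≡⟨ ⊕-assoc _ _ _ ⟨
      (a k ∙ g k ⊕ q ∙ g j) ⊕ comb g a js
        ≡⟨ cong (_⊕ comb g a js) (⊕-comm _ _) ⟩
      (q ∙ g j ⊕ a k ∙ g k) ⊕ comb g a js
        ≡⟨ ⊕-assoc _ _ _ ⟩
      q ∙ g j ⊕ (a k ∙ g k ⊕ comb g a js) ∎
      where open ≡-Reasoning

    -- Uniqueness ensures that changing the coefficient function at one index changes exactly one
    -- summand.
    UniqueComb : Pred A 0ℓ → (A → Λ n) → Λ n → Set
    UniqueComb J g x = ∃[ js ] Unique js × All J js × ∃[ a ] x ≡ comb g a js

    add-term : ∀ {J : Pred A 0ℓ} (g : A → Λ n) {j} q {x} → J j →
               UniqueComb J g x → UniqueComb J g (q ∙ g j ⊕ x)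
    add-term g {j} q Jj (js , unique , Js , a , ≡.refl) with _∈[_]?_ _≟_ j js
    ... | yes j∈js =
      js , unique , Js , a [ j ≔ q ℚ.+ a j ] ,
      ≡.sym (comb-update-∈ g a q unique j∈js)
    -- The function `a` has some value even at the absent index `j`, so it is overwritten, not
    -- increased.
    ... | no  j∉js =
      j ∷ js , ¬Any⇒All¬ js j∉js ∷ unique , Jj ∷ Js , a [ j ≔ q ] ,
      ≡.sym (cong₂ (λ p x → p ∙ g j ⊕ x) (update-≡ a j q) (comb-update-∉ g a q (¬Any⇒All¬ js j∉js)))

-- Spanning, by reduction of leading terms

⟦linearCombination⟧ : ∀ a js → ⟦ linearCombination (R-module n) G a js ⟧ 1Λ ≡ comb ⟦G⟧ a js
⟦linearCombination⟧ a []       = ∙-zeroˡ 1Λ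
⟦linearCombination⟧ a (j ∷ js) = cong (a j ∙ ⟦G⟧ j ⊕_) (⟦linearCombination⟧ a js)

-- Induction on the leading string, in lexicographic order.
leading-induction : (Q : Λ n → Set) → Q 0Λ →
  (∀ α y → Bounded α y → (∀ y′ → Bounded α y′ → coeff α y′ ≡ 0ℚ → Q y′) → Q y) →
  ∀ y → Q y
leading-induction Q Q0 step (scalar q) = step [] (scalar q) tt λ { (scalar _) _ ≡.refl → Q0 }
-- The order looks at the θ₁-part first. Lowering `b` leaves `a` unrestricted, hence the quantifier;
-- once `b` is 0, the induction continues on `a`.
leading-induction Q Q0 step (a +θ b) = leading-induction (λ b → ∀ a → Q (a +θ b))
  (leading-induction (λ a → Q (a +θ 0Λ)) Q0 λ α a bounded ih →
    step (0F ∷ α) (a +θ 0Λ) (bounded , ≡.refl) λ { (a′ +θ _) (bounded′ , ≡.refl) → ih a′ bounded′ })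
  (λ α b bounded ih a →
    step (1F ∷ α) (a +θ b) bounded λ { (a′ +θ b′) bounded′ eq → ih b′ bounded′ eq a′ })
  b a

_≟ᵛ_ : DecidableEquality (Vec Bit n)
_≟ᵛ_ = Vecₚ.≡-dec Finₚ._≟_

ImF⇒comb : (y : Λ n) → ImF y → UniqueComb _≟ᵛ_ BreaksBallot ⟦G⟧ y
ImF⇒comb = leading-induction _ (λ _ → [] , [] , [] , (λ _ → 0ℚ) , ≡.refl) step
  where
  step : ∀ (α : Vec Bit n) y → Bounded α y →
         (∀ y′ → Bounded α y′ → coeff α y′ ≡ 0ℚ → ImF y′ → UniqueComb _≟ᵛ_ BreaksBallot ⟦G⟧ y′) →
         ImF y → UniqueComb _≟ᵛ_ BreaksBallot ⟦G⟧ y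
  step α y bounded ih y∈ with breaks-or-noLeading α
  -- For a ballot `α` the coefficient vanishes already, so the hypothesis applies to `y` itself.
  ... | inj₂ noLeading = ih y bounded (noLeading y∈ bounded) y∈
  ... | inj₁ breaks = ≡.subst (UniqueComb _≟ᵛ_ BreaksBallot ⟦G⟧) restore
      (add-term _≟ᵛ_ ⟦G⟧ c breaks
        (ih y′ (Bounded-⊕ α bounded (Bounded-∙ α (ℚ.- c) (⟦G⟧-bounded α))) coeff-y′
          (⊕-image y∈ (ImF-∙ (ℚ.- c) (I⇒ImF (breaks⇒G∈I α breaks) 1Λ)))))
    where
    open ≡-Reasoning
    -- As `G α` has leading coefficient 1, subtracting `c` times it clears position `α`; the
    -- difference remains in the ideal because `α` breaks the ballot condition.
    c  = coeff α y
    y′ = y ⊕ (ℚ.- c) ∙ ⟦G⟧ α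
    coeff-y′ : coeff α y′ ≡ 0ℚ
    coeff-y′ = begin
      coeff α y′                              ≡⟨ coeff-⊕ α y _ ⟩
      c ℚ.+ coeff α ((ℚ.- c) ∙ ⟦G⟧ α)         ≡⟨ cong (c ℚ.+_) (coeff-∙ α (ℚ.- c) (⟦G⟧ α)) ⟩
      c ℚ.+ (ℚ.- c) ℚ.* coeff α (⟦G⟧ α)       ≡⟨ cong (λ q → c ℚ.+ (ℚ.- c) ℚ.* q) (⟦G⟧-leading α) ⟩
      c ℚ.+ (ℚ.- c) ℚ.* 1ℚ                    ≡⟨ cong (c ℚ.+_) (ℚₚ.*-identityʳ (ℚ.- c)) ⟩
      c ℚ.+ ℚ.- c                             ≡⟨ ℚₚ.+-inverseʳ c ⟩
      0ℚ                                      ∎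
    restore : c ∙ ⟦G⟧ α ⊕ y′ ≡ y
    restore = begin
      c ∙ ⟦G⟧ α ⊕ (y ⊕ (ℚ.- c) ∙ ⟦G⟧ α)  ≡⟨ ⊕-comm _ _ ⟩
      (y ⊕ (ℚ.- c) ∙ ⟦G⟧ α) ⊕ c ∙ ⟦G⟧ α  ≡⟨ ⊕-assoc _ _ _ ⟩
      y ⊕ ((ℚ.- c) ∙ ⟦G⟧ α ⊕ c ∙ ⟦G⟧ α)  ≡⟨ cong (y ⊕_) (∙-distribʳ (ℚ.- c) c (⟦G⟧ α)) ⟨
      y ⊕ (ℚ.- c ℚ.+ c) ∙ ⟦G⟧ α          ≡⟨ cong (λ q → y ⊕ q ∙ ⟦G⟧ α) (ℚₚ.+-inverseˡ c) ⟩
      y ⊕ 0ℚ ∙ ⟦G⟧ α                     ≡⟨ cong (y ⊕_) (∙-zeroˡ (⟦G⟧ α)) ⟩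
      y ⊕ 0Λ                             ≡⟨ ⊕-identityʳ y ⟩
      y                                  ∎

-- Linear independence, by recursion on the first letter

tails : Bit → List (Vec Bit (suc n)) → List (Vec Bit n)
tails b  []              = []
tails 0F ((0F ∷ α) ∷ js) = α ∷ tails 0F js
tails 0F ((1F ∷ α) ∷ js) = tails 0F js
tails 1F ((0F ∷ α) ∷ js) = tails 1F js
tails 1F ((1F ∷ α) ∷ js) = α ∷ tails 1F js

tails-∉ : ∀ b {α : Vec Bit n} js → All ((b ∷ α) ≢_) js → All (α ≢_) (tails b js)
tails-∉ b  []              []       = []
tails-∉ 0F ((0F ∷ β) ∷ js) (α≢ ∷ p) = α≢ ∘ cong (0F ∷_) ∷ tails-∉ 0F js p
tails-∉ 0F ((1F ∷ β) ∷ js) (_ ∷ p)  = tails-∉ 0F js p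
tails-∉ 1F ((0F ∷ β) ∷ js) (_ ∷ p)  = tails-∉ 1F js p
tails-∉ 1F ((1F ∷ β) ∷ js) (α≢ ∷ p) = α≢ ∘ cong (1F ∷_) ∷ tails-∉ 1F js p

tails-unique : ∀ b (js : List (Vec Bit (suc n))) → Unique js → Unique (tails b js)
tails-unique b  []              []       = []
tails-unique 0F ((0F ∷ α) ∷ js) (p ∷ ps) = tails-∉ 0F js p ∷ tails-unique 0F js ps
tails-unique 0F ((1F ∷ α) ∷ js) (_ ∷ ps) = tails-unique 0F js ps
tails-unique 1F ((0F ∷ α) ∷ js) (_ ∷ ps) = tails-unique 1F js ps
tails-unique 1F ((1F ∷ α) ∷ js) (p ∷ ps) = tails-∉ 1F js p ∷ tails-unique 1F js ps

tails-All⁻ : ∀ {P : Pred (Vec Bit (suc n)) 0ℓ} js →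
             All (P ∘ (0F ∷_)) (tails 0F js) → All (P ∘ (1F ∷_)) (tails 1F js) → All P js
tails-All⁻ []              _        _        = []
tails-All⁻ ((0F ∷ α) ∷ js) (p ∷ ps) qs       = p ∷ tails-All⁻ js ps qs
tails-All⁻ ((1F ∷ α) ∷ js) ps       (q ∷ qs) = q ∷ tails-All⁻ js ps qs

⟦G⟧-lower : Vec Bit n → Λ n
⟦G⟧-lower α = proj₁ (⟦G⟧-1∷ α)

-- A block-triangular form: the θ₁-part involves only the words that begin with 1.
comb-tails : ∀ a (js : List (Vec Bit (suc n))) →
  comb ⟦G⟧ a js ≡
  (comb ⟦G⟧ (a ∘ (0F ∷_)) (tails 0F js) ⊕ comb ⟦G⟧-lower (a ∘ (1F ∷_)) (tails 1F js)) +θ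
  comb ⟦G⟧ (a ∘ (1F ∷_)) (tails 1F js)
comb-tails a [] = cong (_+θ 0Λ) (≡.sym (⊕-identityˡ 0Λ))
comb-tails a ((0F ∷ α) ∷ js) = begin
  a (0F ∷ α) ∙ ⟦G⟧ (0F ∷ α) ⊕ comb ⟦G⟧ a js
    ≡⟨ cong₂ (λ g x → a (0F ∷ α) ∙ g ⊕ x) (⟦G⟧-0∷ α) (comb-tails a js) ⟩
  (a (0F ∷ α) ∙ ⟦G⟧ α ⊕ (x ⊕ y)) +θ (a (0F ∷ α) ∙ 0Λ ⊕ z)
    ≡⟨ cong₂ _+θ_ (≡.sym (⊕-assoc _ _ _))
         (≡.trans (cong (_⊕ z) (0-homo (∙-linear (a (0F ∷ α))))) (⊕-identityˡ z)) ⟩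
  ((a (0F ∷ α) ∙ ⟦G⟧ α ⊕ x) ⊕ y) +θ z ∎
  where
  open ≡-Reasoning
  x = comb ⟦G⟧ (a ∘ (0F ∷_)) (tails 0F js)
  y = comb ⟦G⟧-lower (a ∘ (1F ∷_)) (tails 1F js)
  z = comb ⟦G⟧ (a ∘ (1F ∷_)) (tails 1F js)
comb-tails a ((1F ∷ α) ∷ js) = begin
  q ∙ ⟦G⟧ (1F ∷ α) ⊕ comb ⟦G⟧ a js
    ≡⟨ cong₂ (λ g x → q ∙ g ⊕ x) (proj₂ (⟦G⟧-1∷ α)) (comb-tails a js) ⟩
  (q ∙ ⟦G⟧-lower α ⊕ (x ⊕ y)) +θ (q ∙ ⟦G⟧ α ⊕ z)
    ≡⟨ cong (_+θ (q ∙ ⟦G⟧ α ⊕ z)) (begin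
      q ∙ ⟦G⟧-lower α ⊕ (x ⊕ y)  ≡⟨ ⊕-assoc _ _ _ ⟨
      (q ∙ ⟦G⟧-lower α ⊕ x) ⊕ y  ≡⟨ cong (_⊕ y) (⊕-comm _ _) ⟩
      (x ⊕ q ∙ ⟦G⟧-lower α) ⊕ y  ≡⟨ ⊕-assoc _ _ _ ⟩
      x ⊕ (q ∙ ⟦G⟧-lower α ⊕ y)  ∎) ⟩
  (x ⊕ (q ∙ ⟦G⟧-lower α ⊕ y)) +θ (q ∙ ⟦G⟧ α ⊕ z) ∎
  where
  open ≡-Reasoning
  q = a (1F ∷ α)
  x = comb ⟦G⟧ (a ∘ (0F ∷_)) (tails 0F js)
  y = comb ⟦G⟧-lower (a ∘ (1F ∷_)) (tails 1F js)
  z = comb ⟦G⟧ (a ∘ (1F ∷_)) (tails 1F js)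

+θ-injective : ∀ {a b c d : Λ n} → a +θ b ≡ c +θ d → a ≡ c × b ≡ d
+θ-injective ≡.refl = ≡.refl , ≡.refl

-- The θ₁-part first forces the coefficients of words beginning with 1 to vanish. Their `⟦G⟧-lower`
-- terms then disappear, and the other part is a relation among the remaining words.
comb≡0⇒coefficients≡0 : ∀ (js : List (Vec Bit n)) a → Unique js →
                        comb ⟦G⟧ a js ≡ 0Λ → All (λ j → a j ≡ 0ℚ) js
comb≡0⇒coefficients≡0 {zero} []             a _                eq = []
comb≡0⇒coefficients≡0 {zero} ([] ∷ [])      a _                eq = (begin
  a []                                ≡⟨ ℚₚ.*-identityʳ (a []) ⟨
  a [] ℚ.* 1ℚ                         ≡⟨ ℚₚ.+-identityʳ _ ⟨
  coeff [] (a [] ∙ ⟦G⟧ [] ⊕ 0Λ)       ≡⟨ cong (coeff []) eq ⟩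
  0ℚ                                  ∎) ∷ []
  where open ≡-Reasoning
-- There is only one word of length 0, so a list without repetitions has at most one entry.
comb≡0⇒coefficients≡0 {zero} ([] ∷ [] ∷ _) a ((≢ ∷ _) ∷ _)    eq = contradiction ≡.refl ≢
comb≡0⇒coefficients≡0 {suc n} js a unique eq = tails-All⁻ js a₀≡0 a₁≡0
  where
  open ≡-Reasoning
  x = comb ⟦G⟧ (a ∘ (0F ∷_)) (tails 0F js)
  eqs : x ⊕ comb ⟦G⟧-lower (a ∘ (1F ∷_)) (tails 1F js) ≡ 0Λ ×
        comb ⟦G⟧ (a ∘ (1F ∷_)) (tails 1F js) ≡ 0Λ
  eqs = +θ-injective (≡.trans (≡.sym (comb-tails a js)) eq)
  a₁≡0 : All (λ j → a (1F ∷ j) ≡ 0ℚ) (tails 1F js)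
  a₁≡0 = comb≡0⇒coefficients≡0 (tails 1F js) _ (tails-unique 1F js unique) (proj₂ eqs)
  a₀≡0 : All (λ j → a (0F ∷ j) ≡ 0ℚ) (tails 0F js)
  a₀≡0 = comb≡0⇒coefficients≡0 (tails 0F js) _ (tails-unique 0F js unique) (begin
    x                                                      ≡⟨ ⊕-identityʳ x ⟨
    x ⊕ 0Λ                                                 ≡⟨ cong (x ⊕_) (comb-0 ⟦G⟧-lower a₁≡0) ⟨
    x ⊕ comb ⟦G⟧-lower (a ∘ (1F ∷_)) (tails 1F js)         ≡⟨ proj₁ eqs ⟩
    0Λ                                                     ∎)

-- Independence and span carried back to `R n`

theorem4p2 : ∀ (n : ℕ) → 1 ≤ n → IsBasisOf (R-module n) BreaksBallot G (I n)
theorem4p2 n _ = independent , I⊆Span , Span⊆I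
  where
  independent : LinearlyIndependent (R-module n) BreaksBallot G
  independent js unique _ a eq = comb≡0⇒coefficients≡0 js a unique (begin
    comb ⟦G⟧ a js                                  ≡⟨ ⟦linearCombination⟧ a js ⟨
    ⟦ linearCombination (R-module n) G a js ⟧ 1Λ   ≡⟨ ⟦⟧-cong eq 1Λ ⟩
    ⟦ con 0ℚ ⟧ 1Λ                                  ≡⟨ ∙-zeroˡ 1Λ ⟩
    0Λ                                             ∎)
    where open ≡-Reasoning

  I⊆Span : ∀ {x} → I n x → Span (R-module n) BreaksBallot G x
  -- Acting on `1Λ` reads off the coefficients of `x`; injectivity then returns the combination
  -- found there to `R n`.
  I⊆Span {x} x∈I with ImF⇒comb (⟦ x ⟧ 1Λ) (I⇒ImF x∈I 1Λ)
  ... | js , _ , breaks , a , eq =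
    js , breaks , a , ⟦⟧-injective (≡.trans eq (≡.sym (⟦linearCombination⟧ a js)))

  Span⊆I : ∀ {x} → Span (R-module n) BreaksBallot G x → I n x
  Span⊆I (js , breaks , a , eq) = ≈-closed (sym eq) (combination breaks)
    where
    combination : ∀ {js} → All BreaksBallot js → I n (linearCombination (R-module n) G a js)
    combination []                      = 0-closed
    combination {α ∷ _} (breaksα ∷ breaks) =
      +-closed (*-closedˡ (con (a α)) (breaks⇒G∈I α breaksα)) (combination breaks)
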